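{- Let $\Gamma$ be block-finite and let $\mathbb G$ be as below. For every $\hat x\in D^m$ there exists a function $f\in\langle\Gamma\rangle$ of arity $m$ with $\arg\min f=\mathbb G(\hat x)$, where $\mathbb G(\hat x)=\{\mathbf g(\hat x):\mathbf g\in\mathbb G\}$.
   Context: $D$ finite, $m\ge2$, cost functions $f:D^n\to\mathbb Q\cup\{\infty\}$, $\mathrm{dom} f=\{x:f(x)<\infty\}$ (also a $\{0,\infty\}$-valued function). $\Gamma$ is block-finite: $D$ is partitioned into $\{D_v:v\in V\}$ such that (a) for each $a\in D_v$ some unary $g_a:D\to D$ maps $\mathrm{dom} f$ into itself (componentwise) for all $f\in\Gamma$ and $g_a(b)=a$ for all $b\in D_v$; (b) $\mathrm{dom} f\in\Gamma$ for $f\in\Gamma$ and the binary equality function $=_D$ is in $\Gamma$; (c) every $n$-ary $f\in\Gamma\setminus\{=_D\}$ has $\mathrm{dom} f\subseteq D_{v_1}\times\dots\times D_{v_n}$ for some $v_i$. $\langle\Gamma\rangle$: functions $f(x_1,\dots,x_k)=\min_{x_{k+1},\dots,x_N}f_{\mathcal I}(x_1,\dots,x_N)$ for $\mathrm{VCSP}(\Gamma)$ instances $\mathcal I$ ($f_{\mathcal I}$ a finite sum of members of $\Gamma$ applied to variable tuples); $\arg\min f$ is the set of minimizers. Maps $\mathbf g=(g_1,\dots,g_m):D^m\to D^m$ act on $x=(x^1,\dots,x^m)\in[D^n]^m$ coordinatewise; $f^m(x)=\frac1m\sum_i f(x^i)$. A generalized fractional polymorphism of arity $m\to m$: finitely supported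 probability distribution $\rho$ on maps with $\sum\rho(\mathbf g)f^m(\mathbf g(x))\le f^m(x)$ for all $f\in\Gamma$, $x\in[\mathrm{dom} f]^m$. $x^\pi=(x_{\pi(1)},\dots,x_{\pi(m)})$, $\mathbf g^\pi=(g_{\pi(1)},\dots,g_{\pi(m)})$; $\Omega=\{\mathbf g:\mathbf g^\pi(x)=\mathbf g(x^\pi)\ \forall x\in D^m,\pi\}$. $\omega$ is a generalized fractional polymorphism of arity $m\to m$ with support in $\Omega$ whose support contains the support of every other such one; $\mathbb G=\{\mathbf g_k\circ\dots\circ\mathbf g_1:k\ge0,\mathbf g_i\in\mathrm{supp}(\omega)\}$ (identity for $k=0$).
   Formalization: Γ is taken to be finite, since the claim fails for some infinite Γ (e.g. D={a,b,c} with unary costs −1/k, 0, 1 for all k≥1, plus the zero function and equality), and the probabilities of generalized fractional polymorphisms are rational, which gives the same 𝔾 for finite Γ. -}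

module Defs where

open import Data.Bool.Base using (if_then_else_)
open import Data.Nat.Base as ℕ using (ℕ; NonTrivial; nonTrivial⇒nonZero)
open import Data.Integer.Base using (+_)
open import Data.Rational.Base as ℚ using (ℚ; 0ℚ; 1ℚ)
open import Data.Fin.Base using (Fin)
open import Data.Fin.Properties using (_≟_)
open import Data.Fin.Permutation using (Permutation′; _⟨$⟩ʳ_)
open import Data.List.Base as List using (List)
open import Data.List.Relation.Unary.All using (All)
open import Data.List.Relation.Unary.Any using (Any)
open import Data.Vec.Base as Vec using (Vec; []; _∷_; lookup; tabulate; transpose; _++_)
open import Data.Vec.Relation.Unary.All as VecAll using ()
open import Data.Product.Base using (Σ; ∃; _×_; _,_; proj₁; proj₂)
open import Function.Base using (_∘′_; id)
open import Function.Definitions using (Surjective)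
open import Relation.Nullary.Decidable.Core using (does)
open import Relation.Nullary.Negation.Core using (¬_)
open import Relation.Nullary.Construct.Add.Supremum using (_⁺; [_]; ⊤⁺)
open import Relation.Binary.PropositionalEquality.Core using (_≡_; _≗_)
import Relation.Binary.Construct.Add.Supremum.NonStrict as NonStrict
import Relation.Binary.Construct.Add.Supremum.Strict as Strict

open NonStrict ℚ._≤_ public using (_≤⁺_)
open Strict ℚ._<_ public using (_<⁺_)

-- ℚ ∪ {∞}, with ⊤⁺ as ∞.
ℚ∞ : Set
ℚ∞ = ℚ ⁺

infixl 6 _+∞_
infixl 7 _·_

_+∞_ : ℚ∞ → ℚ∞ → ℚ∞
[ p ] +∞ [ q ] = [ p ℚ.+ q ]
[ _ ] +∞ ⊤⁺    = ⊤⁺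
⊤⁺    +∞ _     = ⊤⁺

-- Only ever used with a strictly positive scalar, so that p · ∞ = ∞ is the
-- right value and no convention for 0 · ∞ is involved.
_·_ : ℚ → ℚ∞ → ℚ∞
p · [ q ] = [ p ℚ.* q ]
p · ⊤⁺    = ⊤⁺

sum∞ : List ℚ∞ → ℚ∞
sum∞ = List.foldr _+∞_ [ 0ℚ ]

-- The domain D is Fin d throughout.
CostFn : ℕ → ℕ → Set
CostFn d n = Vec (Fin d) n → ℚ∞

infix 4 _∈dom_ _∈argmin_

_∈dom_ : ∀ {d n} → Vec (Fin d) n → CostFn d n → Set
x ∈dom f = f x <⁺ ⊤⁺

_∈argmin_ : ∀ {d n} → Vec (Fin d) n → CostFn d n → Set
x ∈argmin f = ∀ y → f x ≤⁺ f y

-- dom f viewed as a {0,∞}-valued cost function.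
domFn : ∀ {d n} → CostFn d n → CostFn d n
domFn f x with f x
... | [ _ ] = [ 0ℚ ]
... | ⊤⁺    = ⊤⁺

eqFn : ∀ {d} → CostFn d 2
eqFn (a ∷ b ∷ []) = if does (a ≟ b) then [ 0ℚ ] else ⊤⁺

-- Equality of cost functions is pointwise, since function extensionality is
-- not available; functions of different arities are never equal.
infix 4 _≋_
data _≋_ {d} : ∃ (CostFn d) → ∃ (CostFn d) → Set where
  pointwise : ∀ {n} {f g : CostFn d n} → f ≗ g → (n , f) ≋ (n , g)

-- Languages are finite sets of cost functions of arbitrary arities.
Language : ℕ → Set
Language d = List (∃ (CostFn d))

infix 4 _∈ᶜ_
_∈ᶜ_ : ∀ {d n} → CostFn d n → Language d → Set
_∈ᶜ_ {n = n} f Γ = Any ((n , f) ≋_) Γ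

-- The partition {D_v : v ∈ V} is given by V = Fin k and the surjection
-- block : D → V, so that a ∈ D_v iff block a ≡ v, and x ∈ D_{v₁} × … × D_{vₙ}
-- iff Vec.map block x ≡ v.
record BlockFinite {d} (Γ : Language d) : Set where
  field
    k          : ℕ
    block      : Fin d → Fin k
    surjective : Surjective _≡_ _≡_ block
    retract    : ∀ a → Σ (Fin d → Fin d) λ g →
                   (∀ {n} {f : CostFn d n} → f ∈ᶜ Γ →
                      ∀ x → x ∈dom f → Vec.map g x ∈dom f)
                   × (∀ b → block b ≡ block a → g b ≡ a)
    dom-closed : ∀ {n} {f : CostFn d n} → f ∈ᶜ Γ → domFn f ∈ᶜ Γ
    has-eq     : eqFn ∈ᶜ Γ
    in-blocks  : ∀ {n} {f : CostFn d n} → f ∈ᶜ Γ → ¬ ((n , f) ≋ (2 , eqFn)) →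
                   ∃ λ (v : Vec (Fin k) n) → ∀ x → x ∈dom f → Vec.map block x ≡ v

record Term {d} (Γ : Language d) (N : ℕ) : Set where
  field
    {arity} : ℕ
    cost    : CostFn d arity
    cost∈Γ  : cost ∈ᶜ Γ
    scope   : Vec (Fin N) arity

Instance : ∀ {d} → Language d → ℕ → Set
Instance Γ N = List (Term Γ N)

objective : ∀ {d} {Γ : Language d} {N} → Instance Γ N → CostFn d N
objective I x = sum∞ (List.map (λ t → Term.cost t (Vec.map (lookup x) (Term.scope t))) I)

-- f ∈ ⟨Γ⟩: the value f x is the (attained) minimum of the objective over the
-- values y of the ℓ = N - k auxiliary variables.
infix 4 _∈⟨_⟩
_∈⟨_⟩ : ∀ {d k} → CostFn d k → Language d → Set
_∈⟨_⟩ {d} {k} f Γ =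
  ∃ λ ℓ → Σ (Instance Γ (k ℕ.+ ℓ)) λ I → ∀ x →
    (∀ (y : Vec (Fin d) ℓ) → f x ≤⁺ objective I (x ++ y))
    × (∃ λ (y : Vec (Fin d) ℓ) → f x ≡ objective I (x ++ y))

Map : ℕ → ℕ → Set
Map d m = Vec (Fin d) m → Vec (Fin d) m

-- Action of 𝐠 on [Dⁿ]ᵐ: a tuple (x¹,…,xᵐ) is an m-vector of n-vectors, and 𝐠
-- is applied to each of the n columns (x¹ⱼ,…,xᵐⱼ).
act : ∀ {d m n} → Map d m → Vec (Vec (Fin d) n) m → Vec (Vec (Fin d) n) m
act g x = transpose (Vec.map g (transpose x))

average : ∀ {d n} (m : ℕ) .{{_ : NonTrivial m}} → CostFn d n → Vec (Vec (Fin d) n) m → ℚ∞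
average m f x = (ℚ._/_ (+ 1) m {{nonTrivial⇒nonZero m}}) · sum∞ (Vec.toList (Vec.map f x))

-- A finitely supported probability distribution on Map d m, as a finite list
-- of maps with positive weights. A map may be listed repeatedly, in which case
-- its probability is the sum of the corresponding weights.
record Distribution (d m : ℕ) : Set where
  field
    atoms    : List (ℚ × Map d m)
    positive : All (λ a → 0ℚ ℚ.< proj₁ a) atoms
    total    : List.foldr ℚ._+_ 0ℚ (List.map proj₁ atoms) ≡ 1ℚ

open Distribution

infix 4 _∈supp_
_∈supp_ : ∀ {d m} → Map d m → Distribution d m → Set
g ∈supp ρ = Any (λ a → g ≗ proj₂ a) (atoms ρ)

IsGenFracPol : ∀ {d} → Language d → (m : ℕ) .{{_ : NonTrivial m}} → Distribution d m → Set
IsGenFracPol {d} Γ m ρ =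
  ∀ {n} {f : CostFn d n} → f ∈ᶜ Γ →
  ∀ (x : Vec (Vec (Fin d) n) m) → VecAll.All (_∈dom f) x →
  sum∞ (List.map (λ a → proj₁ a · average m f (act (proj₂ a) x)) (atoms ρ)) ≤⁺ average m f x

permute : ∀ {A : Set} {m} → Permutation′ m → Vec A m → Vec A m
permute π x = tabulate (λ i → lookup x (π ⟨$⟩ʳ i))

-- Membership in Ω; note that 𝐠^π(x) = (g_{π(1)}(x),…,g_{π(m)}(x)) = (𝐠(x))^π.
InΩ : ∀ {d m} → Map d m → Set
InΩ {m = m} g = ∀ x (π : Permutation′ m) → permute π (g x) ≡ g (permute π x)

record IsSymGenFracPol {d} (Γ : Language d) (m : ℕ) .{{_ : NonTrivial m}}
                       (ρ : Distribution d m) : Set where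
  field
    isGenFracPol : IsGenFracPol Γ m ρ
    supp⊆Ω       : ∀ g → g ∈supp ρ → InΩ g

record IsMaximalSym {d} (Γ : Language d) (m : ℕ) .{{_ : NonTrivial m}}
                    (ω : Distribution d m) : Set where
  field
    isSym   : IsSymGenFracPol Γ m ω
    maximal : ∀ ρ → IsSymGenFracPol Γ m ρ → ∀ g → g ∈supp ρ → g ∈supp ω

-- Membership in 𝔾; the list holds 𝐠ₖ, …, 𝐠₁ in this order.
In𝔾 : ∀ {d m} → Distribution d m → Map d m → Set
In𝔾 {d} {m} ω g =
  ∃ λ (gs : List (Map d m)) → All (_∈supp ω) gs × g ≗ List.foldr _∘′_ id gs

infix 4 _∈𝔾[_]_
_∈𝔾[_]_ : ∀ {d m} → Vec (Fin d) m → Distribution d m → Vec (Fin d) m → Set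
y ∈𝔾[ ω ] x = ∃ λ g → In𝔾 ω g × y ≡ g x

{-# OPTIONS --safe #-}

-- Call a map good if it lies in Ω and preserves dom f for every f ∈ Γ. By Farkas' lemma, a good map
-- g₀ outside supp ω is separated by a multiset R of pairs (f, X), X ∈ [dom f]ᵐ: the total cost
-- g ↦ Σ_R Σᵢ f(g(X)ⁱ) is minimal at the identity among all good maps and strictly larger at g₀, for
-- otherwise a symmetric fractional polymorphism with g₀ in its support would exist. The union of
-- these multisets is minimised among good maps only by maps in supp ω, while averaging over ω
-- shows that composing with a map from supp ω preserves optimality, so all of 𝔾 is optimal. An instance
-- whose variables are the entries of the table of g, with equality and domain constraints expressing
-- that g is good, has this total cost as its objective; projecting it to the entries g(x̂) gives f.
module Submission where

open import Data.Nat.Base as ℕ using (ℕ; zero; suc; NonTrivial; nonTrivial⇒nonZero)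
import Data.Nat.Properties as ℕ
open import Data.Integer.Base as ℤ using (-[1+_]) renaming (+_ to pos)
import Data.Integer.Properties as ℤ
open import Data.Rational.Base as ℚ using (ℚ; mkℚ; 0ℚ; 1ℚ; _+_; _*_; _-_; -_; _≤_; _<_; 1/_; toℚᵘ)
import Data.Rational.Properties as ℚ
import Data.Rational.Unnormalised.Base as ℚᵘ
open ℚᵘ using (mkℚᵘ; *≡*)
import Data.Rational.Unnormalised.Properties as ℚᵘ
open import Data.Rational.Solver using (module +-*-Solver)
open +-*-Solver using (solve; _:=_; _:+_; _:*_; _:-_; :-_; con)
open import Algebra.Bundles using (CommutativeRing)
open import Algebra.Properties.Semiring.Mult (CommutativeRing.semiring ℚ.+-*-commutativeRing)
  using (×1-homo-*) renaming (_×_ to _⋆_)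
open import Data.Fin.Base using (Fin; zero; suc; combine; remQuot; _↑ˡ_; _↑ʳ_)
import Data.Fin.Properties as Fin
open import Data.Fin.Permutation as Perm using (Permutation′; _⟨$⟩ʳ_; _∘ₚ_)
import Data.Fin.Permutation.Transposition.List as Transposition
open import Data.List.Base as List using (List; []; _∷_; _++_)
import Data.List.Properties as List
import Data.List.Extrema
open import Data.List.Relation.Unary.All as All using (All; []; _∷_)
import Data.List.Relation.Unary.All.Properties as All
open import Data.List.Relation.Unary.Any as Any using (Any; here; there)
import Data.List.Relation.Unary.Any.Properties as Any
open import Data.List.Membership.Propositional using (_∈_)
open import Data.List.Membership.Propositional.Properties
  using (∈-allFin; ∈-lookup; ∈-map⁺; ∈-filter⁺; ∈-filter⁻; ∈-concatMap⁺; ∈-cartesianProduct⁺;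
         ∈-cartesianProductWith⁺)
open import Data.Vec.Base as Vec using (Vec; []; _∷_; lookup; tabulate; transpose)
import Data.Vec.Properties as Vec
open import Data.Vec.Relation.Unary.All as VecAll using ([]; _∷_)
import Data.Vec.Relation.Unary.All.Properties as VecAll
open import Data.Product.Base using (∃; Σ; _×_; _,_; proj₁; proj₂)
open import Data.Sum.Base using (_⊎_; inj₁; inj₂)
open import Function.Base using (_∘_; _∘′_; id)
open import Function.Bundles using (_⇔_; mk⇔)
open import Level using (0ℓ)
open import Relation.Nullary using (Dec; yes; no; ¬_)
open import Relation.Nullary.Decidable using (_×-dec_; map′; decidable-stable)
open import Relation.Nullary.Negation using (contradiction)
open import Relation.Nullary.Construct.Add.Supremum using ([_]; ⊤⁺)
import Relation.Binary.Construct.Add.Supremum.Strict as Strict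
import Relation.Binary.Construct.Add.Supremum.NonStrict as NonStrict
open Strict ℚ._<_ using ([_]<⊤⁺)
open NonStrict ℚ._≤_ using ([_]; _≤⊤⁺)
open import Relation.Binary.Bundles using (TotalOrder)
open import Relation.Binary.Definitions using (tri<; tri≈; tri>)
open import Relation.Binary.PropositionalEquality
open import Defs
open Distribution

-- Farkas' lemma over ℚ

0≤q-p : ∀ {p q} → p ≤ q → 0ℚ ≤ q - p
0≤q-p {p} {q} p≤q = subst (_≤ q - p) (ℚ.+-inverseʳ p) (ℚ.+-monoˡ-≤ (- p) p≤q)

0≤q-p⇒p≤q : ∀ {p q} → 0ℚ ≤ q - p → p ≤ q
0≤q-p⇒p≤q {p} {q} 0≤ = subst₂ _≤_ (ℚ.+-identityˡ p)
  (solve 2 (λ p q → (q :- p) :+ p := q) refl p q) (ℚ.+-monoˡ-≤ p 0≤)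

0<q-p⇒p<q : ∀ {p q} → 0ℚ < q - p → p < q
0<q-p⇒p<q {p} {q} 0< = subst₂ _<_ (ℚ.+-identityˡ p)
  (solve 2 (λ p q → (q :- p) :+ p := q) refl p q) (ℚ.+-monoˡ-< p 0<)

p≤0⇒0≤-p : ∀ {p} → p ≤ 0ℚ → 0ℚ ≤ - p
p≤0⇒0≤-p = ℚ.neg-antimono-≤

*-nonNeg : ∀ {p q} → 0ℚ ≤ p → 0ℚ ≤ q → 0ℚ ≤ p * q
*-nonNeg {p} {q} 0≤p 0≤q = ℚ.nonNegative⁻¹ (p * q)
  {{ℚ.nonNeg*nonNeg⇒nonNeg p {{ℚ.nonNegative 0≤p}} q {{ℚ.nonNegative 0≤q}}}}

*-pos : ∀ {p q} → 0ℚ < p → 0ℚ < q → 0ℚ < p * q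
*-pos {p} {q} 0<p 0<q = ℚ.positive⁻¹ (p * q)
  {{ℚ.pos*pos⇒pos p {{ℚ.positive 0<p}} q {{ℚ.positive 0<q}}}}

inverse : ∀ {p} → 0ℚ < p → ∃ λ r → 0ℚ < r × r * p ≡ 1ℚ
inverse {p} 0<p = r , ℚ.positive⁻¹ r {{ℚ.1/pos⇒pos p}} , ℚ.*-inverseˡ p {{ℚ.pos⇒nonZero p}}
  where
  instance _ = ℚ.positive 0<p
  r = (1/ p) {{ℚ.pos⇒nonZero p}}

square-nonNeg : ∀ p → 0ℚ ≤ p * p
square-nonNeg p with ℚ.≤-total 0ℚ p
... | inj₁ 0≤p = *-nonNeg 0≤p 0≤p
... | inj₂ p≤0 = subst (0ℚ ≤_) (solve 1 (λ p → (:- p) :* (:- p) := p :* p) refl p)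
                   (*-nonNeg (p≤0⇒0≤-p p≤0) (p≤0⇒0≤-p p≤0))

≤⇒≯ : ∀ {p q} → p ≤ q → ¬ q < p
≤⇒≯ p≤q q<p = ℚ.<-irrefl refl (ℚ.<-≤-trans q<p p≤q)

square-zero : ∀ p → p * p ≤ 0ℚ → p ≡ 0ℚ
square-zero p p²≤0 with ℚ.<-cmp 0ℚ p
... | tri< 0<p _ _ = contradiction (*-pos 0<p 0<p) (≤⇒≯ p²≤0)
... | tri≈ _ 0≡p _ = sym 0≡p
... | tri> _ _ p<0 = contradiction
  (subst (0ℚ <_) (solve 1 (λ p → (:- p) :* (:- p) := p :* p) refl p)
    (*-pos (ℚ.neg-antimono-< p<0) (ℚ.neg-antimono-< p<0))) (≤⇒≯ p²≤0)

Vector : ℕ → Set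
Vector n = Fin n → ℚ

dot : ∀ {n} → Vector n → Vector n → ℚ
dot {zero}  u v = 0ℚ
dot {suc n} u v = u zero * v zero + dot (u ∘ suc) (v ∘ suc)

dot-comm : ∀ {n} (u v : Vector n) → dot u v ≡ dot v u
dot-comm {zero}  u v = refl
dot-comm {suc n} u v = cong₂ _+_ (ℚ.*-comm (u zero) (v zero)) (dot-comm (u ∘ suc) (v ∘ suc))

dot-cong : ∀ {n} {u u′ v v′ : Vector n} → u ≗ u′ → v ≗ v′ → dot u v ≡ dot u′ v′
dot-cong {zero}  _ _ = refl
dot-cong {suc n} p q = cong₂ _+_ (cong₂ _*_ (p zero) (q zero)) (dot-cong (p ∘ suc) (q ∘ suc))

dot-linear : ∀ {n} (u v : Vector n) c w → dot (λ k → u k - c * v k) w ≡ dot u w - c * dot v w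
dot-linear {zero}  u v c w = solve 1 (λ c → con 0ℚ := con 0ℚ :- c :* con 0ℚ) refl c
dot-linear {suc n} u v c w = trans
  (cong ((u zero - c * v zero) * w zero +_) (dot-linear (u ∘ suc) (v ∘ suc) c (w ∘ suc)))
  (solve 6 (λ u v c w x y → (u :- c :* v) :* w :+ (x :- c :* y) := (u :* w :+ x) :- c :* (v :* w :+ y))
    refl (u zero) (v zero) c (w zero) (dot (u ∘ suc) (w ∘ suc)) (dot (v ∘ suc) (w ∘ suc)))

dot-linearʳ : ∀ {n} (w u v : Vector n) c → dot w (λ k → u k - c * v k) ≡ dot w u - c * dot w v
dot-linearʳ w u v c = trans (dot-comm w _) (trans (dot-linear u v c w)
  (cong₂ (λ a b → a - c * b) (dot-comm u w) (dot-comm v w)))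

dot-scaleʳ : ∀ {n} (w u : Vector n) c → dot w (λ k → c * u k) ≡ c * dot w u
dot-scaleʳ {zero}  w u c = sym (ℚ.*-zeroʳ c)
dot-scaleʳ {suc n} w u c = trans
  (cong (w zero * (c * u zero) +_) (dot-scaleʳ (w ∘ suc) (u ∘ suc) c))
  (solve 4 (λ w c u x → w :* (c :* u) :+ c :* x := c :* (w :* u :+ x)) refl (w zero) c (u zero) (dot (w ∘ suc) (u ∘ suc)))

dot-nonNeg : ∀ {n} (u : Vector n) → 0ℚ ≤ dot u u
dot-nonNeg {zero}  u = ℚ.≤-refl
dot-nonNeg {suc n} u = subst (_≤ dot u u) (ℚ.+-identityˡ 0ℚ)
  (ℚ.+-mono-≤ (square-nonNeg (u zero)) (dot-nonNeg (u ∘ suc)))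

dot-definite : ∀ {n} (u : Vector n) → dot u u ≤ 0ℚ → ∀ k → u k ≡ 0ℚ
dot-definite {suc n} u u·u≤0 zero    = square-zero (u zero) (ℚ.≤-trans
  (subst (_≤ dot u u) (ℚ.+-identityʳ _) (ℚ.+-monoʳ-≤ (u zero * u zero) (dot-nonNeg (u ∘ suc)))) u·u≤0)
dot-definite {suc n} u u·u≤0 (suc k) = dot-definite (u ∘ suc) (ℚ.≤-trans
  (subst (_≤ dot u u) (ℚ.+-identityˡ _)
    (ℚ.+-monoˡ-≤ (dot (u ∘ suc) (u ∘ suc)) (square-nonNeg (u zero)))) u·u≤0) k

unit : ∀ {n} → Fin n → Vector n
unit zero    zero    = 1ℚ
unit zero    (suc _) = 0ℚ
unit (suc _) zero    = 0ℚ
unit (suc i) (suc j) = unit i j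

unit-nonNeg : ∀ {n} (i j : Fin n) → 0ℚ ≤ unit i j
unit-nonNeg zero    zero    = ℚ.<⇒≤ (ℚ.positive⁻¹ 1ℚ)
unit-nonNeg zero    (suc _) = ℚ.≤-refl
unit-nonNeg (suc _) zero    = ℚ.≤-refl
unit-nonNeg (suc i) (suc j) = unit-nonNeg i j

dot-zero : ∀ {n} (v : Vector n) → dot (λ _ → 0ℚ) v ≡ 0ℚ
dot-zero {zero}  v = refl
dot-zero {suc n} v = trans (cong₂ _+_ (ℚ.*-zeroˡ (v zero)) (dot-zero (v ∘ suc))) (ℚ.+-identityˡ 0ℚ)

dot-unit : ∀ {n} (i : Fin n) v → dot (unit i) v ≡ v i
dot-unit zero    v = trans (cong₂ _+_ (ℚ.*-identityˡ (v zero)) (dot-zero (v ∘ suc))) (ℚ.+-identityʳ _)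
dot-unit (suc i) v = trans (cong₂ _+_ (ℚ.*-zeroˡ (v zero)) (dot-unit i (v ∘ suc))) (ℚ.+-identityˡ _)

-- Cone as u: u is a combination of the vectors as with nonnegative coefficients.
Cone : ∀ {n k} → Vec (Vector k) n → Vector k → Set
Cone []       u = ∀ k → u k ≡ 0ℚ
Cone (a ∷ as) u = ∃ λ μ → 0ℚ ≤ μ × Cone as (λ k → u k - μ * a k)

cone-resp : ∀ {n k} (as : Vec (Vector k) n) {u v} → u ≗ v → Cone as u → Cone as v
cone-resp []       u≗v c           = λ k → trans (sym (u≗v k)) (c k)
cone-resp (a ∷ as) u≗v (μ , 0≤ , c) = μ , 0≤ , cone-resp as (λ k → cong (_- μ * a k) (u≗v k)) c

-- When `dot a x` is 1, this is the projection along `a` onto the hyperplane orthogonal to `x`.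
project : ∀ {k} → Vector k → Vector k → Vector k → Vector k
project a x v k = v k - dot v x * a k

-- Undoing the projection of a generator `v` with coefficient `μ` releases the multiple
-- `μ * - dot v x` of `a`. It is nonnegative because `dot v x ≤ 0`, and `ν` collects all of these.
cone-unproject : ∀ {n k} (as : Vec (Vector k) n) a x → VecAll.All (λ v → dot v x ≤ 0ℚ) as →
  ∀ u → Cone (Vec.map (project a x) as) u → ∃ λ ν → 0ℚ ≤ ν × Cone as (λ k → u k - ν * a k)
cone-unproject []       a x []       u c = 0ℚ , ℚ.≤-refl ,
  λ k → trans (solve 2 (λ u a → u :- con 0ℚ :* a := u) refl (u k) (a k)) (c k)
cone-unproject (v ∷ as) a x (p ∷ ps) u (μ , 0≤μ , c) with cone-unproject as a x ps _ c
... | ν , 0≤ν , c′ = ν + μ * - dot v x ,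
  subst (_≤ ν + μ * - dot v x) (ℚ.+-identityˡ 0ℚ) (ℚ.+-mono-≤ 0≤ν (*-nonNeg 0≤μ (p≤0⇒0≤-p p))) ,
  μ , 0≤μ , cone-resp as (λ k → solve 6
    (λ u μ v t a ν → (u :- μ :* (v :- t :* a)) :- ν :* a := (u :- (ν :+ μ :* (:- t)) :* a) :- μ :* v)
    refl (u k) μ (v k) (dot v x) (a k) ν) c′

-- Bartl's induction: if the separator x found for as has a·x > 0, rescale it to a·x = 1 and
-- recurse on the projections of as and b along a, which are orthogonal to x.
farkas : ∀ {n k} (as : Vec (Vector k) n) (b : Vector k) →
  Cone as b ⊎ ∃ λ y → VecAll.All (λ a → dot a y ≤ 0ℚ) as × 0ℚ < dot b y
-- The empty cone is the origin: a nonzero `b` separates itself from it.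
farkas [] b with 0ℚ ℚ.<? dot b b
... | yes 0< = inj₂ (b , [] , 0<)
... | no  0≮ = inj₁ (dot-definite b (ℚ.≮⇒≥ 0≮))
farkas (a ∷ as) b with farkas as b
... | inj₁ c = inj₁ (0ℚ , ℚ.≤-refl ,
  cone-resp as (λ k → solve 2 (λ u a → u := u :- con 0ℚ :* a) refl (b k) (a k)) c)
... | inj₂ (x₀ , as≤0 , b>0) with dot a x₀ ℚ.≤? 0ℚ
...   | yes a≤0 = inj₂ (x₀ , a≤0 ∷ as≤0 , b>0)
...   | no  a≰0 with inverse (ℚ.≰⇒> a≰0)
...     | r , r>0 , ra≡1 with farkas (Vec.map (project a x) as) (project a x b)
  where x = λ k → r * x₀ k
-- Since `b` is its projection plus `dot b x` times `a`, the coefficient of `a` is `dot b x + ν`,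
-- and `dot b x` is positive.
...       | inj₁ c = let ν , 0≤ν , c′ = cone-unproject as a x as·x≤0 _ c in
  inj₁ (dot b x + ν ,
    subst (_≤ dot b x + ν) (ℚ.+-identityˡ 0ℚ) (ℚ.+-mono-≤ (ℚ.<⇒≤ b·x>0) 0≤ν) ,
    cone-resp as (λ k → solve 4 (λ b t a ν → (b :- t :* a) :- ν :* a := b :- (t :+ ν) :* a)
      refl (b k) (dot b x) (a k) ν) c′)
  where
  x = λ k → r * x₀ k
  as·x≤0 : VecAll.All (λ v → dot v x ≤ 0ℚ) as
  as·x≤0 = VecAll.map (λ {v} p → subst (_≤ 0ℚ) (sym (dot-scaleʳ v x₀ r))
    (subst (r * dot v x₀ ≤_) (ℚ.*-zeroʳ r) (ℚ.*-monoˡ-≤-nonNeg r {{ℚ.nonNegative (ℚ.<⇒≤ r>0)}} p))) as≤0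
  b·x>0 : 0ℚ < dot b x
  b·x>0 = subst (0ℚ <_) (sym (dot-scaleʳ b x₀ r)) (*-pos r>0 b>0)
...       | inj₂ (z , as≤ , b>) = inj₂ (y ,
    ℚ.≤-reflexive a·y≡0 ∷ VecAll.map (λ {v} → subst (_≤ 0ℚ) (project-dot v)) (VecAll.map⁻ as≤) ,
    subst (0ℚ <_) (project-dot b) b>)
  where
  x = λ k → r * x₀ k
  -- Moving the projection from the generators to the separator: `dot (project a x v) z` equals
  -- `dot v y` for every `v`, and `y` is orthogonal to `a` because `dot a x` is 1.
  y = λ k → z k - dot a z * x k
  project-dot : ∀ v → dot (project a x v) z ≡ dot v y
  project-dot v = trans (dot-linear v a (dot v x) z) (trans
    (solve 3 (λ p q s → p :- q :* s := p :- s :* q) refl (dot v z) (dot v x) (dot a z))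
    (sym (dot-linearʳ v z x (dot a z))))
  a·y≡0 : dot a y ≡ 0ℚ
  a·y≡0 = trans (dot-linearʳ a z x (dot a z)) (trans
    (cong (λ t → dot a z - dot a z * t) (trans (dot-scaleʳ a x₀ r) ra≡1))
    (solve 1 (λ p → p :- p :* con 1ℚ := con 0ℚ) refl (dot a z)))

cone-++ : ∀ {m n k} (as : Vec (Vector k) m) (bs : Vec (Vector k) n) {u} → Cone (as Vec.++ bs) u →
  ∃ λ w → Cone bs w × Cone as (λ k → u k - w k)
cone-++ []       bs {u} c = u , c , λ k → ℚ.+-inverseʳ (u k)
cone-++ (a ∷ as) bs {u} (μ , 0≤μ , c) with cone-++ as bs c
... | w , cw , cas = w , cw , μ , 0≤μ , cone-resp as
  (λ k → solve 4 (λ u μ a w → (u :- μ :* a) :- w := (u :- w) :- μ :* a) refl (u k) μ (a k) (w k)) cas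

cone-nonNeg : ∀ {n k} (as : Vec (Vector k) n) → VecAll.All (λ a → ∀ k → 0ℚ ≤ a k) as →
  ∀ {u} → Cone as u → ∀ k → 0ℚ ≤ u k
cone-nonNeg []       []       c k = ℚ.≤-reflexive (sym (c k))
cone-nonNeg (a ∷ as) (p ∷ ps) {u} (μ , 0≤μ , c) k = 0≤q-p⇒p≤q (subst (0ℚ ≤_)
  (solve 3 (λ u μ a → (u :- μ :* a) :+ μ :* a := u :- con 0ℚ) refl (u k) μ (a k))
  (subst (_≤ u k - μ * a k + μ * a k) (ℚ.+-identityˡ 0ℚ)
    (ℚ.+-mono-≤ (cone-nonNeg as ps c k) (*-nonNeg 0≤μ (p k)))))

-- Farkas' lemma for `- b`, with the unit vectors added to the generators. In the first alternative
-- they are slack variables, turning an equation into an inequality; in the second they force the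
-- sign of every coordinate of the separator, which is negated to give `y`.
separation : ∀ {n k} (as : Vec (Vector k) n) (b : Vector k) →
  (∃ λ u → Cone as u × (∀ k → u k + b k ≤ 0ℚ)) ⊎
  (∃ λ y → (∀ k → 0ℚ ≤ y k) × VecAll.All (λ a → 0ℚ ≤ dot a y) as × 0ℚ < dot b y)
separation {k = k} as b with farkas (as Vec.++ Vec.tabulate unit) (λ i → - b i)
... | inj₁ c = let w , cw , cas = cone-++ as _ c in
  inj₁ (_ , cas , λ i → subst (_≤ 0ℚ)
    (solve 2 (λ b w → :- w := (:- b :- w) :+ b) refl (b i) (w i))
    (ℚ.neg-antimono-≤ (cone-nonNeg (Vec.tabulate unit) (VecAll.tabulate⁺ unit-nonNeg) cw i)))
... | inj₂ (x , as≤0 , b>0) = inj₂ ((λ i → - 1ℚ * x i) ,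
    (λ i → subst (0ℚ ≤_) (trans (ℚ.neg-distribˡ-* 1ℚ (dot (unit i) x)) (cong (- 1ℚ *_) (dot-unit i x)))
       (flip (dot (unit i) x) (VecAll.tabulate⁻ (VecAll.++ʳ⁻ as as≤0) i))) ,
    VecAll.map (λ {a} p → subst (0ℚ ≤_) (trans (ℚ.neg-distribˡ-* 1ℚ (dot a x)) (sym (dot-scaleʳ a x (- 1ℚ))))
       (flip (dot a x) p)) (VecAll.++ˡ⁻ as as≤0) ,
    subst (0ℚ <_) lem b>0)
  where
  flip : ∀ p → p ≤ 0ℚ → 0ℚ ≤ - (1ℚ * p)
  flip p p≤0 = subst (0ℚ ≤_) (cong -_ (sym (ℚ.*-identityˡ p))) (p≤0⇒0≤-p p≤0)
  lem : dot (λ i → - b i) x ≡ dot b (λ i → - 1ℚ * x i)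
  lem = trans (dot-comm _ x) (trans
    (dot-cong (λ _ → refl) (λ i → solve 1 (λ b → :- b := con (- 1ℚ) :* b) refl (b i)))
    (trans (dot-scaleʳ x b (- 1ℚ)) (trans (cong (- 1ℚ *_) (dot-comm x b)) (sym (dot-scaleʳ b x (- 1ℚ))))))

-- Sums over lists and clearing of denominators

sumℚ : List ℚ → ℚ
sumℚ = List.foldr _+_ 0ℚ

∑ : ∀ {A : Set} → (A → ℚ) → List A → ℚ
∑ u xs = sumℚ (List.map u xs)

∑-++ : ∀ {A : Set} (u : A → ℚ) xs ys → ∑ u (xs ++ ys) ≡ ∑ u xs + ∑ u ys
∑-++ u []       ys = sym (ℚ.+-identityˡ _)
∑-++ u (x ∷ xs) ys = trans (cong (u x +_) (∑-++ u xs ys)) (sym (ℚ.+-assoc (u x) _ _))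

ι : ℕ → ℚ
ι n = n ⋆ 1ℚ

ι-* : ∀ m n → ι (m ℕ.* n) ≡ ι m * ι n
ι-* = ×1-homo-*

toℚᵘ-ι : ∀ n → toℚᵘ (ι n) ℚᵘ.≃ mkℚᵘ (pos n) 0
toℚᵘ-ι zero    = *≡* refl
toℚᵘ-ι (suc n) = ℚᵘ.≃-trans (ℚ.toℚᵘ-homo-+ 1ℚ (ι n)) (ℚᵘ.≃-trans
  (ℚᵘ.+-congʳ (mkℚᵘ (pos 1) 0) (toℚᵘ-ι n))
  (*≡* (cong (ℤ._* pos 1) (cong (λ t → pos 1 ℤ.+ t) (ℤ.*-identityʳ (pos n))))))

ι-suc-pos : ∀ n → 0ℚ < ι (suc n)
ι-suc-pos zero    = ℚ.positive⁻¹ 1ℚ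
ι-suc-pos (suc n) = ℚ.<-trans (ι-suc-pos n)
  (subst (_< 1ℚ + ι (suc n)) (ℚ.+-identityˡ _) (ℚ.+-monoˡ-< (ι (suc n)) (ℚ.positive⁻¹ 1ℚ)))

fraction : ∀ p → 0ℚ ≤ p → ∃ λ a → ∃ λ b → 0ℚ < ι b × ι b * p ≡ ι a
fraction p@(mkℚ (pos a) b-1 _) _ = a , suc b-1 , ι-suc-pos b-1 , ℚ.toℚᵘ-injective
  (ℚᵘ.≃-trans (ℚ.toℚᵘ-homo-* (ι (suc b-1)) p)
  (ℚᵘ.≃-trans (ℚᵘ.*-congʳ {toℚᵘ p} (toℚᵘ-ι (suc b-1)))
  (ℚᵘ.≃-trans (*≡* lem) (ℚᵘ.≃-sym (toℚᵘ-ι a)))))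
  where
  lem : (pos (suc b-1) ℤ.* pos a) ℤ.* pos 1 ≡ pos a ℤ.* pos (1 ℕ.* suc b-1)
  lem = trans (ℤ.*-identityʳ _) (trans (ℤ.*-comm (pos (suc b-1)) (pos a))
    (cong (λ n → pos a ℤ.* pos n) (sym (ℕ.*-identityˡ (suc b-1)))))
fraction (mkℚ -[1+ _ ] _ _) (ℚ.*≤* ())

copies : ∀ {A : Set} → ℕ → List A → List A
copies n xs = List.concat (List.replicate n xs)

∑-copies : ∀ {A : Set} (u : A → ℚ) n xs → ∑ u (copies n xs) ≡ ι n * ∑ u xs
∑-copies u zero    xs = sym (ℚ.*-zeroˡ (∑ u xs))
∑-copies u (suc n) xs = trans (∑-++ u xs (copies n xs)) (trans
  (cong (∑ u xs +_) (∑-copies u n xs))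
  (solve 2 (λ s n → s :+ n :* s := (con 1ℚ :+ n) :* s) refl (∑ u xs) (ι n)))

-- Denominators are cleared one coordinate at a time, so that index `k` is listed `N` times `y k`
-- times. If the tail has common denominator `N` and the head is `a / b`, the new denominator is
-- `N ℕ.* b`: the head index is listed `N ℕ.* a` times and the list of the tail is repeated `b`
-- times.
multiset : ∀ {n} (y : Vector n) → (∀ k → 0ℚ ≤ y k) →
  ∃ λ N → 0ℚ < ι N × ∃ λ ks → ∀ u → ∑ u ks ≡ ι N * dot u y
multiset {zero}  y 0≤y = 1 , ι-suc-pos 0 , [] , λ u → refl
multiset {suc n} y 0≤y with fraction (y zero) (0≤y zero) | multiset (y ∘ suc) (0≤y ∘ suc)
... | a , b , 0<b , by≡a | N , 0<N , ks , eq =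
  N ℕ.* b , subst (0ℚ <_) (sym (ι-* N b)) (*-pos 0<N 0<b) ,
  copies (N ℕ.* a) (zero ∷ []) ++ copies b (List.map suc ks) , λ u → begin
    ∑ u (copies (N ℕ.* a) (zero ∷ []) ++ copies b (List.map suc ks))
      ≡⟨ ∑-++ u (copies (N ℕ.* a) (zero ∷ [])) _ ⟩
    ∑ u (copies (N ℕ.* a) (zero ∷ [])) + ∑ u (copies b (List.map suc ks))
      ≡⟨ cong₂ _+_ (∑-copies u (N ℕ.* a) (zero ∷ [])) (∑-copies u b _) ⟩
    ι (N ℕ.* a) * (u zero + 0ℚ) + ι b * ∑ u (List.map suc ks)
      ≡⟨ cong₂ (λ s t → s * (u zero + 0ℚ) + ι b * t) (trans (ι-* N a) (cong (ι N *_) (sym by≡a)))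
           (trans (cong sumℚ (sym (List.map-∘ ks))) (eq (u ∘ suc))) ⟩
    ι N * (ι b * y zero) * (u zero + 0ℚ) + ι b * (ι N * dot (u ∘ suc) (y ∘ suc))
      ≡⟨ solve 5 (λ N b y u s → N :* (b :* y) :* (u :+ con 0ℚ) :+ b :* (N :* s) := N :* b :* (u :* y :+ s))
           refl (ι N) (ι b) (y zero) (u zero) (dot (u ∘ suc) (y ∘ suc)) ⟩
    ι N * ι b * dot u y
      ≡⟨ cong (_* dot u y) (sym (ι-* N b)) ⟩
    ι (N ℕ.* b) * dot u y ∎
  where open ≡-Reasoning

-- Costs, tuples and weighted means

-- Junk value: value ∞ = 0.
value : ℚ∞ → ℚ
value [ q ] = q
value ⊤⁺    = 0ℚ

Finite : ℚ∞ → Set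
Finite q = q <⁺ ⊤⁺

[value] : ∀ {q} → Finite q → q ≡ [ value q ]
[value] [ _ ]<⊤⁺ = refl

≤-finite : ∀ {p q} → p ≤⁺ [ q ] → Finite p
≤-finite [ _ ] = [ _ ]<⊤⁺

+∞-finite⁻ : ∀ p q → Finite (p +∞ q) → Finite p × Finite q
+∞-finite⁻ [ p ] [ q ] _ = [ p ]<⊤⁺ , [ q ]<⊤⁺

·-finite⁻ : ∀ w q → Finite (w · q) → Finite q
·-finite⁻ w [ q ] _ = [ q ]<⊤⁺

sum∞-finite⁻ : ∀ qs → Finite (sum∞ qs) → All Finite qs
sum∞-finite⁻ []       _ = []
sum∞-finite⁻ (q ∷ qs) p = let fq , fqs = +∞-finite⁻ q (sum∞ qs) p in fq ∷ sum∞-finite⁻ qs fqs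

sum∞-++ : ∀ ps qs → sum∞ (ps ++ qs) ≡ sum∞ ps +∞ sum∞ qs
sum∞-++ []           qs with sum∞ qs
... | [ q ] = cong [_] (sym (ℚ.+-identityˡ q))
... | ⊤⁺    = refl
sum∞-++ (⊤⁺ ∷ ps)    qs = refl
sum∞-++ ([ p ] ∷ ps) qs rewrite sum∞-++ ps qs with sum∞ ps | sum∞ qs
... | [ r ] | [ q ] = cong [_] (sym (ℚ.+-assoc p r q))
... | [ r ] | ⊤⁺    = refl
... | ⊤⁺    | _     = refl

sum∞-zero : ∀ {qs} → All (_≡ [ 0ℚ ]) qs → sum∞ qs ≡ [ 0ℚ ]
sum∞-zero []           = refl
sum∞-zero (refl ∷ eqs) = cong ([ 0ℚ ] +∞_) (sum∞-zero eqs)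

Vec-ext : ∀ {A : Set} {n} {u v : Vec A n} → (∀ i → lookup u i ≡ lookup v i) → u ≡ v
Vec-ext {u = u} {v} eq = trans (sym (Vec.tabulate∘lookup u))
  (trans (Vec.tabulate-cong eq) (Vec.tabulate∘lookup v))

module _ {A : Set} where

  lookup-transpose : ∀ {m n} (X : Vec (Vec A n) m) j i →
    lookup (lookup (transpose X) j) i ≡ lookup (lookup X i) j
  lookup-transpose {n = n} (v ∷ X) j i = trans (cong (λ c → lookup c i) column) (split i)
    where
    cons : A → Vec A _ → Vec A _
    cons = _∷_
    column : lookup (transpose (v ∷ X)) j ≡ lookup v j ∷ lookup (transpose X) j
    column = trans (Vec.lookup-⊛ j (Vec.replicate n cons Vec.⊛ v) (transpose X))
      (cong (λ h → h (lookup (transpose X) j)) (trans (Vec.lookup-⊛ j (Vec.replicate n cons) v)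
        (cong (λ h → h (lookup v j)) (Vec.lookup-replicate j cons))))
    split : ∀ i → lookup (lookup v j ∷ lookup (transpose X) j) i ≡ lookup (lookup (v ∷ X) i) j
    split zero    = refl
    split (suc i) = lookup-transpose X j i

  transpose-involutive : ∀ {m n} (X : Vec (Vec A n) m) → transpose (transpose X) ≡ X
  transpose-involutive X = Vec-ext λ i → Vec-ext λ j →
    trans (lookup-transpose (transpose X) i j) (lookup-transpose X j i)

  lookup-transpose-map : ∀ {m n} (X : Vec (Vec A n) m) j →
    lookup (transpose X) j ≡ Vec.map (λ v → lookup v j) X
  lookup-transpose-map X j = Vec-ext λ i →
    trans (lookup-transpose X j i) (sym (Vec.lookup-map i (λ v → lookup v j) X))

  lookup-permute : ∀ {m} (π : Permutation′ m) (x : Vec A m) i →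
    lookup (permute π x) i ≡ lookup x (π ⟨$⟩ʳ i)
  lookup-permute π x i = Vec.lookup∘tabulate _ i

  vectors : List A → ∀ n → List (Vec A n)
  vectors xs zero    = [] ∷ []
  vectors xs (suc n) = List.cartesianProductWith _∷_ xs (vectors xs n)

  ∈-vectors : ∀ {xs} → (∀ x → x ∈ xs) → ∀ {n} (v : Vec A n) → v ∈ vectors xs n
  ∈-vectors all []      = here refl
  ∈-vectors all (x ∷ v) = ∈-cartesianProductWith⁺ _∷_ (all x) (∈-vectors all v)

Matrix : ℕ → ℕ → ℕ → Set
Matrix d m n = Vec (Vec (Fin d) n) m

module _ {d m : ℕ} where

  act-id : ∀ {n} (X : Matrix d m n) → act id X ≡ X
  act-id X = trans (cong transpose (Vec.map-id (transpose X))) (transpose-involutive X)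

  act-∘ : ∀ {n} (h g : Map d m) (X : Matrix d m n) → act (h ∘′ g) X ≡ act h (act g X)
  act-∘ h g X = cong transpose (trans (Vec.map-∘ h g (transpose X))
    (cong (Vec.map h) (sym (transpose-involutive (Vec.map g (transpose X))))))

  act-cong : ∀ {n} {g h : Map d m} → g ≗ h → (X : Matrix d m n) → act g X ≡ act h X
  act-cong eq X = cong transpose (Vec.map-cong eq (transpose X))

  -- Row `i` of the image depends only on the component `i` of `g`, applied to the columns of `X`.
  -- In this form it can be matched with the scope of a term.
  act-row : ∀ {n} (g : Map d m) (X : Matrix d m n) i →
    lookup (act g X) i ≡ Vec.map (λ c → lookup (g c) i) (transpose X)
  act-row g X i = trans (lookup-transpose-map (Vec.map g (transpose X)) i)
    (sym (Vec.map-∘ (λ v → lookup v i) g (transpose X)))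

  InΩ-cong : ∀ (g h : Map d m) → g ≗ h → InΩ g → InΩ h
  InΩ-cong g h eq p x π = trans (cong (permute π) (sym (eq x))) (trans (p x π) (eq (permute π x)))

  InΩ-id : InΩ {d} {m} id
  InΩ-id x π = refl

  InΩ-∘ : ∀ (h g : Map d m) → InΩ h → InΩ g → InΩ (h ∘′ g)
  InΩ-∘ h g p q x π = trans (p (g x) π) (cong h (q x π))

  Symmetricᵗ : Map d m → Set
  Symmetricᵗ g = ∀ x i j → permute (Perm.transpose i j) (g x) ≡ g (permute (Perm.transpose i j) x)

  permute-∘ : ∀ (π ρ : Permutation′ m) (x : Vec (Fin d) m) → permute (π ∘ₚ ρ) x ≡ permute π (permute ρ x)
  permute-∘ π ρ x = Vec.tabulate-cong λ i → sym (lookup-permute ρ x (π ⟨$⟩ʳ i))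

  -- Every permutation is a product of transpositions, and commuting with `g` is inherited by
  -- products. This reduces membership in `Ω` to conditions indexed by pairs of coordinates.
  transpositions-suffice : ∀ (g : Map d m) → Symmetricᵗ g → InΩ g
  transpositions-suffice g sy x π = trans (permute-cong (g x))
    (trans (eval-sym (Transposition.decompose π)) (cong g (sym (permute-cong x))))
    where
    permute-cong : ∀ y → permute π y ≡ permute (Transposition.eval (Transposition.decompose π)) y
    permute-cong y = Vec.tabulate-cong λ i → cong (lookup y) (sym (Transposition.eval-decompose π i))
    eval-sym : ∀ ts → permute (Transposition.eval ts) (g x) ≡ g (permute (Transposition.eval ts) x)
    eval-sym []             = trans (Vec.tabulate∘lookup (g x)) (cong g (sym (Vec.tabulate∘lookup x)))
    eval-sym ((i , j) ∷ ts) = begin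
      permute (t ∘ₚ e) (g x)        ≡⟨ permute-∘ t e (g x) ⟩
      permute t (permute e (g x))   ≡⟨ cong (permute t) (eval-sym ts) ⟩
      permute t (g (permute e x))   ≡⟨ sy (permute e x) i j ⟩
      g (permute t (permute e x))   ≡⟨ cong g (sym (permute-∘ t e x)) ⟩
      g (permute (t ∘ₚ e) x)        ∎
      where
      open ≡-Reasoning
      t = Perm.transpose i j
      e = Transposition.eval ts

  AllDom : ∀ {n} → CostFn d n → Matrix d m n → Set
  AllDom f = VecAll.All (_∈dom f)

-- Rational-valued, so that linear algebra over ℚ applies. It is the true sum only when every row of
-- the matrix lies in `dom f`; otherwise infinite costs count as 0.
total-cost : ∀ {d n m} → CostFn d n → Vec (Vec (Fin d) n) m → ℚ
total-cost f []      = 0ℚ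
total-cost f (x ∷ X) = value (f x) + total-cost f X

sum∞-total : ∀ {d n m} {f : CostFn d n} {X : Vec (Vec (Fin d) n) m} → VecAll.All (_∈dom f) X →
  sum∞ (Vec.toList (Vec.map f X)) ≡ [ total-cost f X ]
sum∞-total []       = refl
sum∞-total (p ∷ ps) = cong₂ _+∞_ ([value] p) (sum∞-total ps)

sum∞-dom : ∀ {d n m} {f : CostFn d n} (X : Vec (Vec (Fin d) n) m) →
  Finite (sum∞ (Vec.toList (Vec.map f X))) → VecAll.All (_∈dom f) X
sum∞-dom []      _ = []
sum∞-dom {f = f} (x ∷ X) p = let fx , fX = +∞-finite⁻ (f x) _ p in fx ∷ sum∞-dom X fX

total-cost-cong : ∀ {d n m} {f g : CostFn d n} → f ≗ g → (X : Vec (Vec (Fin d) n) m) →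
  total-cost f X ≡ total-cost g X
total-cost-cong eq []      = refl
total-cost-cong eq (x ∷ X) = cong₂ _+_ (cong value (eq x)) (total-cost-cong eq X)

-- The weights need not sum to 1: the combinations that Farkas' lemma yields are normalised only
-- later.
Weighted : Set → Set
Weighted A = List (ℚ × A)

mean : ∀ {A : Set} → (A → ℚ) → Weighted A → ℚ
mean φ = ∑ (λ (w , g) → w * φ g)

mean-linear : ∀ {A : Set} (φ ψ : A → ℚ) c (as : Weighted A) →
  mean (λ g → φ g + c * ψ g) as ≡ mean φ as + c * mean ψ as
mean-linear φ ψ c []             = solve 1 (λ c → con 0ℚ := con 0ℚ :+ c :* con 0ℚ) refl c
mean-linear φ ψ c ((w , g) ∷ as) = trans (cong (w * (φ g + c * ψ g) +_) (mean-linear φ ψ c as))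
  (solve 6 (λ w p c q x y → w :* (p :+ c :* q) :+ (x :+ c :* y) := (w :* p :+ x) :+ c :* (w :* q :+ y))
    refl w (φ g) c (ψ g) (mean φ as) (mean ψ as))

mean-cong : ∀ {A : Set} {φ ψ : A → ℚ} → φ ≗ ψ → ∀ (as : Weighted A) → mean φ as ≡ mean ψ as
mean-cong eq []             = refl
mean-cong eq ((w , g) ∷ as) = cong₂ _+_ (cong (w *_) (eq g)) (mean-cong eq as)

scale : ∀ {A : Set} → ℚ → Weighted A → Weighted A
scale r = List.map (λ (w , g) → r * w , g)

mean-scale : ∀ {A : Set} (φ : A → ℚ) r (as : Weighted A) → mean φ (scale r as) ≡ r * mean φ as
mean-scale φ r []             = sym (ℚ.*-zeroʳ r)
mean-scale φ r ((w , g) ∷ as) = trans (cong (r * w * φ g +_) (mean-scale φ r as))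
  (solve 4 (λ r w p x → r :* w :* p :+ r :* x := r :* (w :* p :+ x)) refl r w (φ g) (mean φ as))

weight : ∀ {A : Set} → Weighted A → ℚ
weight as = ∑ proj₁ as

weight-mean : ∀ {A : Set} c (as : Weighted A) → mean (λ _ → c) as ≡ c * weight as
weight-mean c []             = sym (ℚ.*-zeroʳ c)
weight-mean c ((w , _) ∷ as) = trans (cong (w * c +_) (weight-mean c as))
  (solve 3 (λ w c s → w :* c :+ c :* s := c :* (w :+ s)) refl w c (weight as))

weight-scale : ∀ {A : Set} r (as : Weighted A) → weight (scale r as) ≡ r * weight as
weight-scale r []             = sym (ℚ.*-zeroʳ r)
weight-scale r ((w , _) ∷ as) = trans (cong (r * w +_) (weight-scale r as)) (sym (ℚ.*-distribˡ-+ r w (weight as)))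

Positive : ∀ {A : Set} → Weighted A → Set
Positive = All (λ a → 0ℚ < proj₁ a)

mean-nonNeg : ∀ {A : Set} {φ : A → ℚ} {as : Weighted A} → Positive as →
  All (λ a → 0ℚ ≤ φ (proj₂ a)) as → 0ℚ ≤ mean φ as
mean-nonNeg []       []       = ℚ.≤-refl
mean-nonNeg {φ = φ} {(w , g) ∷ as} (p ∷ ps) (q ∷ qs) =
  subst (_≤ mean φ ((w , g) ∷ as)) (ℚ.+-identityˡ 0ℚ) (ℚ.+-mono-≤ (*-nonNeg (ℚ.<⇒≤ p) q) (mean-nonNeg ps qs))

-- A sum of nonnegative terms that is at most 0 has only zero terms, and the positive weights
-- cancel. Applied to the excess over a minimum, it turns an inequality on average into an equality
-- at every atom.
mean-vanish : ∀ {A : Set} {φ : A → ℚ} {as : Weighted A} → Positive as →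
  All (λ a → 0ℚ ≤ φ (proj₂ a)) as → mean φ as ≤ 0ℚ → All (λ a → φ (proj₂ a) ≡ 0ℚ) as
mean-vanish []       []       _ = []
mean-vanish {φ = φ} {(w , g) ∷ as} (p ∷ ps) (q ∷ qs) le =
  ℚ.≤-antisym
    (ℚ.*-cancelˡ-≤-pos w {{ℚ.positive p}} (subst (w * φ g ≤_) (sym (ℚ.*-zeroʳ w))
      (ℚ.≤-trans (subst (_≤ mean φ ((w , g) ∷ as)) (ℚ.+-identityʳ (w * φ g))
        (ℚ.+-monoʳ-≤ (w * φ g) (mean-nonNeg ps qs))) le))) q
  ∷ mean-vanish ps qs (ℚ.≤-trans (subst (_≤ mean φ ((w , g) ∷ as)) (ℚ.+-identityˡ (mean φ as))
      (ℚ.+-monoˡ-≤ (mean φ as) (*-nonNeg (ℚ.<⇒≤ p) q))) le)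

∑-cong : ∀ {A : Set} {u v : A → ℚ} → u ≗ v → ∀ xs → ∑ u xs ≡ ∑ v xs
∑-cong eq xs = cong sumℚ (List.map-cong eq xs)

-- Exchanging the two sums lets an inequality for the mean be applied to each `b` separately.
mean-∑ : ∀ {A B : Set} (φ : B → A → ℚ) (bs : List B) (as : Weighted A) →
  mean (λ g → ∑ (λ b → φ b g) bs) as ≡ ∑ (λ b → mean (φ b) as) bs
mean-∑ φ []       as = trans (weight-mean 0ℚ as) (ℚ.*-zeroˡ (weight as))
mean-∑ φ (b ∷ bs) as = trans
  (mean-cong (λ g → cong (φ b g +_) (sym (ℚ.*-identityˡ (∑ (λ b → φ b g) bs)))) as)
  (trans (mean-linear (φ b) (λ g → ∑ (λ b → φ b g) bs) 1ℚ as)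
  (cong (mean (φ b) as +_) (trans (ℚ.*-identityˡ _) (mean-∑ φ bs as))))

-- The multiset of costs separating supp ω

finite? : ∀ q → Dec (Finite q)
finite? [ q ] = yes [ q ]<⊤⁺
finite? ⊤⁺    = no λ ()

-- Generators with coefficient 0 are dropped, because the atoms of a distribution must have positive
-- weight.
cone-atoms : ∀ {A : Set} {k} (col : A → Vector k) gs {v} → Cone (Vec.map col (Vec.fromList gs)) v →
  ∃ λ (as : Weighted A) → Positive as × All (λ a → proj₂ a ∈ gs) as × ∀ i → mean (λ g → col g i) as ≡ v i
cone-atoms col []       c = [] , [] , [] , λ i → sym (c i)
cone-atoms col (g ∷ gs) {v} (μ , 0≤μ , c) with cone-atoms col gs c | 0ℚ ℚ.<? μ
... | as , ps , ∈gs , eq | yes 0<μ = (μ , g) ∷ as , 0<μ ∷ ps , here refl ∷ All.map there ∈gs ,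
  λ i → trans (cong (μ * col g i +_) (eq i)) (solve 2 (λ p v → p :+ (v :- p) := v) refl (μ * col g i) (v i))
... | as , ps , ∈gs , eq | no  0≮μ = as , ps , All.map there ∈gs ,
  λ i → trans (eq i) (trans (cong (λ t → v i - t * col g i) (ℚ.≤-antisym (ℚ.≮⇒≥ 0≮μ) 0≤μ))
    (solve 2 (λ v c → v :- con 0ℚ :* c := v) refl (v i) (col g i)))

module _ {A B : Set} (cost : A → B → ℚ) (base : B → ℚ) (gs : List A) (bs : List B) where

  private
    row : Fin (List.length bs) → B
    row = List.lookup bs

    excess : A → Vector (List.length bs)
    excess g k = cost g (row k) - base (row k)

    ∑-excess : ∀ g ks → ∑ (excess g) ks ≡ ∑ (cost g) (List.map row ks) - ∑ base (List.map row ks)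
    ∑-excess g []       = sym (ℚ.+-inverseʳ 0ℚ)
    ∑-excess g (k ∷ ks) = trans (cong (excess g k +_) (∑-excess g ks))
      (solve 4 (λ a b x y → (a :- b) :+ (x :- y) := (a :+ x) :- (b :+ y)) refl (cost g (row k))
        (base (row k)) (∑ (cost g) (List.map row ks)) (∑ base (List.map row ks)))

  Dominating : Weighted A → Set
  Dominating as = ∀ {b} → b ∈ bs → mean (λ g → cost g b) as ≤ weight as * base b

  -- This is `separation` for the vectors of excess cost, with one coordinate per position in `bs`.
  -- Either `g₀` and a nonnegative combination of `gs` have total excess at most 0 in every
  -- coordinate, or there are nonnegative weights on the coordinates, which `multiset` makes into
  -- repetitions in `R`.
  combination-or-multiset : ∀ g₀ →
    (∃ λ as → Positive as × All (λ a → proj₂ a ∈ gs) as × Dominating ((1ℚ , g₀) ∷ as)) ⊎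
    (∃ λ R → All (_∈ bs) R × All (λ g → ∑ base R ≤ ∑ (cost g) R) gs × ∑ base R < ∑ (cost g₀) R)
  combination-or-multiset g₀ with separation (Vec.map excess (Vec.fromList gs)) (excess g₀)
  ... | inj₁ (v , c , v+g₀≤0) with cone-atoms excess gs c
  ...   | as , ps , as∈ , eq = inj₁ (as , ps , as∈ , λ {b} b∈ →
    subst (λ b → mean (λ g → cost g b) as′ ≤ weight as′ * base b)
      (sym (Any.lookup-index b∈)) (le (Any.index b∈)))
    where
    as′ : Weighted A
    as′ = (1ℚ , g₀) ∷ as
    le : ∀ k → mean (λ g → cost g (row k)) as′ ≤ weight as′ * base (row k)
    le k = 0≤q-p⇒p≤q (subst (0ℚ ≤_) (begin
        - (v k + excess g₀ k)
          ≡⟨ cong (λ t → - (t + excess g₀ k)) (sym (eq k)) ⟩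
        - (mean (λ g → excess g k) as + excess g₀ k)
          ≡⟨ cong (λ t → - (t + excess g₀ k)) (trans (mean-cong
               (λ g → solve 2 (λ a b → a :- b := a :+ con (- 1ℚ) :* b) refl (cost g (row k)) C) as)
               (trans (mean-linear (λ g → cost g (row k)) (λ _ → C) (- 1ℚ) as)
                 (cong (λ t → mean (λ g → cost g (row k)) as + - 1ℚ * t) (weight-mean C as)))) ⟩
        - ((mean (λ g → cost g (row k)) as + - 1ℚ * (C * weight as)) + (cost g₀ (row k) - C))
          ≡⟨ solve 4 (λ s C w a → :- ((s :+ con (- 1ℚ) :* (C :* w)) :+ (a :- C))
               := (con 1ℚ :+ w) :* C :- (con 1ℚ :* a :+ s)) refl
               (mean (λ g → cost g (row k)) as) C (weight as) (cost g₀ (row k)) ⟩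
        weight as′ * C - mean (λ g → cost g (row k)) as′ ∎)
      (p≤0⇒0≤-p (v+g₀≤0 k)))
      where
      open ≡-Reasoning
      C = base (row k)
  combination-or-multiset g₀ | inj₂ (y , 0≤y , gs≥0 , g₀>0) with multiset y 0≤y
  ... | N , 0<N , ks , ∑≡ = inj₂ (List.map row ks , All.map⁺ (All.universal ∈-lookup ks) ,
    All.map (λ {g} p → 0≤q-p⇒p≤q (subst (0ℚ ≤_) (difference g) (*-nonNeg (ℚ.<⇒≤ 0<N) p)))
      (VecAll.fromList⁻ (VecAll.map⁻ gs≥0)) ,
    0<q-p⇒p<q (subst (0ℚ <_) (difference g₀) (*-pos 0<N g₀>0)))
    where
    difference : ∀ g → ι N * dot (excess g) y ≡ ∑ (cost g) (List.map row ks) - ∑ base (List.map row ks)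
    difference g = trans (sym (∑≡ (excess g))) (∑-excess g ks)

-- Maps as finite tables

module Tables (d m : ℕ) where

  columns : List (Vec (Fin d) m)
  columns = vectors (List.allFin d) m

  ∈-columns : ∀ x → x ∈ columns
  ∈-columns = ∈-vectors ∈-allFin

  tableSize : ℕ
  tableSize = List.length columns ℕ.* m

  -- The table position that holds coordinate `i` of the value at `x`.
  cell : Vec (Fin d) m → Fin m → Fin tableSize
  cell x i = combine (Any.index (∈-columns x)) i

  toMap : Vec (Fin d) tableSize → Map d m
  toMap z x = tabulate λ i → lookup z (cell x i)

  fromMap : Map d m → Vec (Fin d) tableSize
  fromMap g = tabulate λ c → let x , i = remQuot m c in lookup (g (List.lookup columns x)) i

  lookup-toMap : ∀ z x i → lookup (toMap z x) i ≡ lookup z (cell x i)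
  lookup-toMap z x i = Vec.lookup∘tabulate _ i

  -- `cell` points to a position where `columns` lists `x`, and `remQuot` inverts `combine`. Hence
  -- ranging over `tables` reaches every map up to pointwise equality.
  toMap-fromMap : ∀ g → toMap (fromMap g) ≗ g
  toMap-fromMap g x = Vec-ext λ i → trans (lookup-toMap (fromMap g) x i)
    (trans (Vec.lookup∘tabulate _ (cell x i))
    (trans (cong (λ (a , b) → lookup (g (List.lookup columns a)) b)
             (Fin.remQuot-combine (Any.index (∈-columns x)) i))
    (cong (λ y → lookup (g y) i) (sym (Any.lookup-index (∈-columns x))))))

  tables : List (Vec (Fin d) tableSize)
  tables = vectors (List.allFin d) tableSize

  _≗?_ : (g h : Map d m) → Dec (g ≗ h)
  g ≗? h = map′ (λ all x → All.lookup all (∈-columns x)) (λ eq → All.universal eq columns)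
    (All.all? (λ x → Vec.≡-dec Fin._≟_ (g x) (h x)) columns)

  supp? : ∀ (ω : Distribution d m) g → Dec (g ∈supp ω)
  supp? ω g = Any.any? (λ a → g ≗? proj₂ a) (atoms ω)

-- Good maps and the finite linear system

module Polymorphisms {d : ℕ} (Γ : Language d) (m : ℕ) .{{_ : NonTrivial m}} where

  open Tables d m

  1/m : ℚ
  1/m = (pos 1 ℚ./ m) {{nonTrivial⇒nonZero m}}

  instance
    1/m-positive : ℚ.Positive 1/m
    1/m-positive = ℚ.normalize-pos 1 m {{nonTrivial⇒nonZero m}}

  record Good (g : Map d m) : Set where
    field
      symmetric : InΩ g
      preserves : ∀ {n} {f : CostFn d n} → f ∈ᶜ Γ → ∀ X → AllDom f X → AllDom f (act g X)
  open Good

  good-id : Good id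
  good-id .symmetric = InΩ-id
  good-id .preserves {f = f} _ X p = subst (AllDom f) (sym (act-id X)) p

  good-∘ : ∀ {h g} → Good h → Good g → Good (h ∘′ g)
  good-∘ {h} {g} p q .symmetric = InΩ-∘ h g (p .symmetric) (q .symmetric)
  good-∘ {h} {g} p q .preserves {f = f} f∈ X r = subst (AllDom f) (sym (act-∘ h g X))
    (p .preserves f∈ (act g X) (q .preserves f∈ X r))

  good-cong : ∀ {g h} → g ≗ h → Good g → Good h
  good-cong {g} {h} eq p .symmetric = InΩ-cong g h eq (p .symmetric)
  good-cong eq p .preserves {f = f} f∈ X r = subst (AllDom f) (act-cong eq X) (p .preserves f∈ X r)

  module _ {n} {f : CostFn d n} {X : Matrix d m n} where

    sum∞-mean : ∀ {as : Weighted (Map d m)} → All (λ a → AllDom f (act (proj₂ a) X)) as →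
      sum∞ (List.map (λ a → proj₁ a · average m f (act (proj₂ a) X)) as)
        ≡ [ 1/m * mean (λ g → total-cost f (act g X)) as ]
    sum∞-mean []       = cong [_] (sym (ℚ.*-zeroʳ 1/m))
    sum∞-mean {(w , g) ∷ as} (p ∷ ps) = trans
      (cong₂ (λ s t → w · (1/m · s) +∞ t) (sum∞-total p) (sum∞-mean ps))
      (cong [_] (solve 4 (λ w u x y → w :* (u :* x) :+ u :* y := u :* (w :* x :+ y))
        refl w 1/m (total-cost f (act g X)) (mean (λ g → total-cost f (act g X)) as)))

    sum∞-mean-dom : ∀ (as : Weighted (Map d m)) →
      Finite (sum∞ (List.map (λ a → proj₁ a · average m f (act (proj₂ a) X)) as)) →
      All (λ a → AllDom f (act (proj₂ a) X)) as
    sum∞-mean-dom as fin = All.map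
      (λ {a} p → sum∞-dom (act (proj₂ a) X) (·-finite⁻ 1/m _ (·-finite⁻ (proj₁ a) _ p)))
      (All.map⁻ (sum∞-finite⁻ _ fin))

  module _ {ω : Distribution d m} (pol : IsGenFracPol Γ m ω)
           {n} {f : CostFn d n} (f∈ : f ∈ᶜ Γ) (X : Matrix d m n) (dom : AllDom f X) where

    private
      bound : sum∞ (List.map (λ a → proj₁ a · average m f (act (proj₂ a) X)) (atoms ω))
                ≤⁺ [ 1/m * total-cost f X ]
      bound = subst (sum∞ (List.map (λ a → proj₁ a · average m f (act (proj₂ a) X)) (atoms ω)) ≤⁺_)
        (cong (1/m ·_) (sum∞-total dom)) (pol f∈ X dom)

    -- The average at `X` is finite and bounds the weighted sum of averages, so no summand can be
    -- infinite.
    polymorphism-dom : All (λ a → AllDom f (act (proj₂ a) X)) (atoms ω)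
    polymorphism-dom = sum∞-mean-dom {f = f} {X} (atoms ω) (≤-finite bound)

    polymorphism-mean : mean (λ g → total-cost f (act g X)) (atoms ω) ≤ total-cost f X
    polymorphism-mean = ℚ.*-cancelˡ-≤-pos 1/m
      (NonStrict.[≤]-injective ℚ._≤_ (subst (_≤⁺ [ 1/m * total-cost f X ])
        (sum∞-mean {f = f} {X} polymorphism-dom) bound))

  -- A row of the linear system: a cost function with an argument matrix. The function is given by
  -- its position in `Γ`, so that all rows can be enumerated.
  Row : Set
  Row = Σ (Fin (List.length Γ)) λ i → Matrix d m (proj₁ (List.lookup Γ i))

  fn : (r : Row) → CostFn d (proj₁ (List.lookup Γ (proj₁ r)))
  fn (i , _) = proj₂ (List.lookup Γ i)

  fn∈ : ∀ r → fn r ∈ᶜ Γ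
  fn∈ (i , _) = Any.map (λ { refl → pointwise λ _ → refl }) (∈-lookup {xs = Γ} i)

  RowDom : Row → Map d m → Set
  RowDom r g = AllDom (fn r) (act g (proj₂ r))

  rowDom? : ∀ r g → Dec (RowDom r g)
  rowDom? r g = VecAll.all? (λ x → finite? (fn r x)) (act g (proj₂ r))

  allRows : List Row
  allRows = List.concatMap (λ i → List.map (i ,_) (vectors (vectors (List.allFin d) _) m))
    (List.allFin (List.length Γ))

  rows : List Row
  rows = List.filter (λ r → rowDom? r id) allRows

  rows-dom : ∀ {r} → r ∈ rows → AllDom (fn r) (proj₂ r)
  rows-dom {r} r∈ = subst (AllDom (fn r)) (act-id (proj₂ r))
    (All.lookup (All.all-filter (λ r → rowDom? r id) allRows) r∈)

  cost : Map d m → Row → ℚ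
  cost g r = total-cost (fn r) (act g (proj₂ r))

  cost-cong : ∀ {g h} → g ≗ h → cost g ≗ cost h
  cost-cong eq r = cong (total-cost (fn r)) (act-cong eq (proj₂ r))

  private
    transfer : ∀ {n} {f : CostFn d n} {p} → (n , f) ≋ p → (X : Matrix d m n) → AllDom f X →
      Σ (Matrix d m (proj₁ p)) λ Y → AllDom (proj₂ p) Y
        × (∀ g → total-cost (proj₂ p) (act g Y) ≡ total-cost f (act g X))
        × (∀ g → AllDom (proj₂ p) (act g Y) → AllDom f (act g X))
    transfer (pointwise eq) X dom = X , VecAll.map (λ {x} → subst Finite (eq x)) dom ,
      (λ g → total-cost-cong (sym ∘ eq) (act g X)) ,
      (λ g → VecAll.map (λ {x} → subst Finite (sym (eq x))))

  -- Membership in `Γ` means pointwise equality with a listed function, and `transfer` carries the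
  -- matrix across it. Statements about all functions in `Γ` and all matrices in their domains thus
  -- reduce to the finite list `rows`.
  row-complete : ∀ {n} {f : CostFn d n} → f ∈ᶜ Γ → ∀ X → AllDom f X →
    ∃ λ r → r ∈ rows × (∀ g → cost g r ≡ total-cost f (act g X))
                     × (∀ g → RowDom r g → AllDom f (act g X))
  row-complete f∈ X dom =
    let i = Any.index f∈
        Y , domY , costs , doms = transfer (Any.lookup-index f∈) X dom
    in (i , Y) , ∈-filter⁺ (λ r → rowDom? r id)
         (∈-concatMap⁺ _ (Any.map (λ { refl → ∈-map⁺ (i ,_) (∈-vectors (∈-vectors ∈-allFin) Y) }) (∈-allFin i)))
         (subst (AllDom _) (sym (act-id Y)) domY) , costs , doms

  swaps : List (Vec (Fin d) m × Fin m × Fin m)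
  swaps = List.cartesianProduct columns (List.cartesianProduct (List.allFin m) (List.allFin m))

  SwapInvariant : Map d m → Vec (Fin d) m × Fin m × Fin m → Set
  SwapInvariant g (x , i , j) = permute (Perm.transpose i j) (g x) ≡ g (permute (Perm.transpose i j) x)

  -- A finite, decidable form of `Good`. The same conditions are later written as constraints of the
  -- instance.
  Checked : Map d m → Set
  Checked g = All (SwapInvariant g) swaps × All (λ r → RowDom r g) rows

  checked? : ∀ g → Dec (Checked g)
  checked? g = All.all? (λ _ → Vec.≡-dec Fin._≟_ _ _) swaps ×-dec All.all? (λ r → rowDom? r g) rows

  checked⇒good : ∀ {g} → Checked g → Good g
  checked⇒good {g} (sw , _) .symmetric = transpositions-suffice g λ x i j →
    All.lookup sw (∈-cartesianProduct⁺ (∈-columns x) (∈-cartesianProduct⁺ (∈-allFin i) (∈-allFin j)))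
  checked⇒good {g} (_ , ro) .preserves f∈ X dom =
    let r , r∈ , _ , doms = row-complete f∈ X dom in doms g (All.lookup ro r∈)

  good⇒checked : ∀ {g} → Good g → Checked g
  good⇒checked p = All.universal (λ (x , i , j) → p .symmetric x (Perm.transpose i j)) swaps ,
    All.tabulate λ {r} r∈ → p .preserves (fn∈ r) (proj₂ r) (rows-dom r∈)

  goodMaps : List (Map d m)
  goodMaps = List.filter checked? (List.map toMap tables)

  goodMaps-good : ∀ {g} → g ∈ goodMaps → Good g
  goodMaps-good g∈ = checked⇒good (proj₂ (∈-filter⁻ checked? {xs = List.map toMap tables} g∈))

  goodMaps-complete : ∀ {g} → Good g → ∃ λ h → h ∈ goodMaps × g ≗ h
  goodMaps-complete {g} p = toMap (fromMap g) , ∈-filter⁺ checked?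
    (∈-map⁺ toMap (∈-vectors ∈-allFin (fromMap g)))
    (good⇒checked (good-cong (sym ∘ toMap-fromMap g) p)) , sym ∘ toMap-fromMap g

  -- Dividing by the total weight gives a distribution with the same atoms, and `row-complete`
  -- extends the inequalities on `rows` to all functions in `Γ`.
  normalise : ∀ as → Positive as → 0ℚ < weight as → All (Good ∘ proj₂) as →
    (∀ {r} → r ∈ rows → mean (λ g → cost g r) as ≤ weight as * cost id r) →
    ∃ λ ρ → IsSymGenFracPol Γ m ρ × (∀ {g} → Any (λ a → g ≗ proj₂ a) as → g ∈supp ρ)
  normalise as ps 0<w goods le with inverse 0<w
  ... | c , 0<c , cw≡1 = ρ , record
    { isGenFracPol = isPol
    ; supp⊆Ω = λ g g∈ → let p , eq = All.lookupAny goods′ g∈ in InΩ-cong _ g (sym ∘ eq) (p .symmetric)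
    } , Any.map⁺
    where
    goods′ : All (Good ∘ proj₂) (scale c as)
    goods′ = All.map⁺ goods
    ρ : Distribution d m
    ρ = record
      { atoms    = scale c as
      ; positive = All.map⁺ (All.map (*-pos 0<c) ps)
      ; total    = trans (weight-scale c as) cw≡1
      }
    isPol : IsGenFracPol Γ m ρ
    isPol {f = f} f∈ X dom with row-complete f∈ X dom
    ... | r , r∈ , costs , _ = subst₂ _≤⁺_
      (sym (sum∞-mean {f = f} {X} {scale c as} (All.map (λ p → p .preserves f∈ X dom) goods′)))
      (cong (1/m ·_) (sym (sum∞-total dom)))
      [ ℚ.*-monoˡ-≤-nonNeg 1/m {{ℚ.pos⇒nonNeg 1/m}} (begin
        mean (λ g → total-cost f (act g X)) (scale c as)
          ≡⟨ mean-scale _ c as ⟩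
        c * mean (λ g → total-cost f (act g X)) as
          ≡⟨ cong (c *_) (mean-cong (sym ∘ costs) as) ⟩
        c * mean (λ g → cost g r) as
          ≤⟨ ℚ.*-monoˡ-≤-nonNeg c {{ℚ.nonNegative (ℚ.<⇒≤ 0<c)}} (le r∈) ⟩
        c * (weight as * cost id r)
          ≡⟨ sym (ℚ.*-assoc c (weight as) (cost id r)) ⟩
        c * weight as * cost id r
          ≡⟨ cong (_* cost id r) cw≡1 ⟩
        1ℚ * cost id r
          ≡⟨ ℚ.*-identityˡ (cost id r) ⟩
        cost id r
          ≡⟨ trans (costs id) (cong (total-cost f) (act-id X)) ⟩
        total-cost f X ∎) ]
      where open ℚ.≤-Reasoning

  -- Optimality of generated maps and separation from the support

  module _ {ω : Distribution d m} (isMaximal : IsMaximalSym Γ m ω) where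

    open IsMaximalSym isMaximal
    open IsSymGenFracPol isSym

    supp-good : ∀ {h} → h ∈supp ω → Good h
    supp-good h∈ .symmetric = supp⊆Ω _ h∈
    supp-good h∈ .preserves {f = f} f∈ X dom =
      let p , eq = All.lookupAny (polymorphism-dom {ω} isGenFracPol f∈ X dom) h∈
      in subst (AllDom f) (act-cong (sym ∘ eq) X) p

    module _ (R : List Row) (R⊆rows : All (_∈ rows) R)
             (id-minimal : ∀ {g} → Good g → ∑ (cost id) R ≤ ∑ (cost g) R) where

      private
        -- For each row in `R` the polymorphism inequality is applied at the matrix
        -- `act g (proj₂ r)`, which stays in the domain because `g` is good; these inequalities are
        -- then added.
        average-step : ∀ {g} → Good g → mean (λ h → ∑ (cost (h ∘′ g)) R) (atoms ω) ≤ ∑ (cost g) R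
        average-step {g} p = subst (_≤ ∑ (cost g) R)
          (sym (mean-∑ (λ r h → cost (h ∘′ g) r) R (atoms ω))) (go R⊆rows)
          where
          go : ∀ {R} → All (_∈ rows) R → ∑ (λ r → mean (λ h → cost (h ∘′ g) r) (atoms ω)) R ≤ ∑ (cost g) R
          go []                 = ℚ.≤-refl
          go {r ∷ _} (r∈ ∷ R∈) = ℚ.+-mono-≤
            (subst (_≤ cost g r)
              (mean-cong (λ h → cong (total-cost (fn r)) (sym (act-∘ h g (proj₂ r)))) (atoms ω))
              (polymorphism-mean {ω} isGenFracPol (fn∈ r) (act g (proj₂ r))
                (p .preserves (fn∈ r) (proj₂ r) (rows-dom r∈))))
            (go R∈)

      -- The costs of h ∘ g (h ∈ supp ω) are all at least that of id, and their ω-average is at most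
      -- the cost of g.
      supp-preserves-optimality : ∀ {g h} → Good g → h ∈supp ω → ∑ (cost g) R ≡ ∑ (cost id) R →
        ∑ (cost (h ∘′ g)) R ≡ ∑ (cost id) R
      supp-preserves-optimality {g} {h} p h∈ eq =
        let zero-excess , h≗ = All.lookupAny (mean-vanish {φ = excess} (positive ω) excess-nonNeg mean-excess) h∈
        in trans (∑-cong (cost-cong (λ x → h≗ (g x))) R)
             (trans (solve 2 (λ a M → a := (a :+ con (- 1ℚ) :* M) :+ M) refl
                 (∑ (cost (proj₂ (Any.lookup h∈) ∘′ g)) R) M)
               (trans (cong (_+ M) zero-excess) (ℚ.+-identityˡ M)))
        where
        M = ∑ (cost id) R
        excess : Map d m → ℚ
        excess h = ∑ (cost (h ∘′ g)) R + - 1ℚ * M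
        excess-nonNeg : All (λ a → 0ℚ ≤ excess (proj₂ a)) (atoms ω)
        excess-nonNeg = All.tabulate λ {a} a∈ → subst (0ℚ ≤_)
          (solve 2 (λ c M → c :- M := c :+ con (- 1ℚ) :* M) refl (∑ (cost (proj₂ a ∘′ g)) R) M)
          (0≤q-p (id-minimal (good-∘ (supp-good (Any.map (λ { refl _ → refl }) a∈)) p)))
        mean-excess : mean excess (atoms ω) ≤ 0ℚ
        mean-excess = begin
          mean excess (atoms ω)
            ≡⟨ mean-linear (λ h → ∑ (cost (h ∘′ g)) R) (λ _ → M) (- 1ℚ) (atoms ω) ⟩
          mean (λ h → ∑ (cost (h ∘′ g)) R) (atoms ω) + - 1ℚ * mean (λ _ → M) (atoms ω)
            ≤⟨ ℚ.+-monoˡ-≤ _ (ℚ.≤-trans (average-step p) (ℚ.≤-reflexive eq)) ⟩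
          M + - 1ℚ * mean (λ _ → M) (atoms ω)
            ≡⟨ cong (λ t → M + - 1ℚ * t) (trans (weight-mean M (atoms ω)) (cong (M *_) (total ω))) ⟩
          M + - 1ℚ * (M * 1ℚ)
            ≡⟨ solve 1 (λ M → M :+ con (- 1ℚ) :* (M :* con 1ℚ) := con 0ℚ) refl M ⟩
          0ℚ ∎
          where open ℚ.≤-Reasoning

      -- Induction on the number of factors, starting at the identity, which attains the minimum by
      -- assumption.
      generated-optimal : ∀ {gs} → All (_∈supp ω) gs →
        Good (List.foldr _∘′_ id gs) × ∑ (cost (List.foldr _∘′_ id gs)) R ≡ ∑ (cost id) R
      generated-optimal []         = good-id , refl
      generated-optimal (h∈ ∷ gs∈) = let p , eq = generated-optimal gs∈ in
        good-∘ (supp-good h∈) p , supp-preserves-optimality p h∈ eq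

    -- The first alternative of `combination-or-multiset` would normalise to a symmetric fractional
    -- polymorphism with `g₀` in its support, against maximality of `ω`.
    separate : ∀ {g₀} → Good g₀ → ¬ g₀ ∈supp ω → ∃ λ R → All (_∈ rows) R
      × (∀ {g} → Good g → ∑ (cost id) R ≤ ∑ (cost g) R) × ∑ (cost id) R < ∑ (cost g₀) R
    separate {g₀} p g₀∉ with combination-or-multiset cost (cost id) goodMaps rows g₀
    ... | inj₁ (as , ps , as∈ , le) =
      let ρ , ρ-sym , supp = normalise ((1ℚ , g₀) ∷ as) (0<1 ∷ ps) 0<w (p ∷ All.map goodMaps-good as∈) le
      in contradiction (maximal ρ ρ-sym g₀ (supp (here λ _ → refl))) g₀∉
      where
      0<1 : 0ℚ < 1ℚ
      0<1 = ℚ.positive⁻¹ 1ℚ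
      0<w : 0ℚ < 1ℚ + weight as
      0<w = ℚ.<-≤-trans 0<1 (subst (_≤ 1ℚ + weight as) (ℚ.+-identityʳ 1ℚ) (ℚ.+-monoʳ-≤ 1ℚ
        (subst (0ℚ ≤_) (trans (weight-mean 1ℚ as) (ℚ.*-identityˡ (weight as)))
          (mean-nonNeg {φ = λ _ → 1ℚ} ps (All.universal (λ _ → ℚ.<⇒≤ 0<1) as)))))
    ... | inj₂ (R , R∈ , min , strict) = R , R∈ , (λ {g} q →
      let h , h∈ , g≗h = goodMaps-complete q in
      subst (∑ (cost id) R ≤_) (∑-cong (cost-cong (sym ∘ g≗h)) R) (All.lookup min h∈)) , strict

    -- Multisets are concatenated. The identity is minimal for each of them, so it stays minimal for
    -- the total, and strictness in one of them is enough for strictness in the total.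
    separate-all : ∀ {gs} → All Good gs → ∃ λ R → All (_∈ rows) R
      × (∀ {g} → Good g → ∑ (cost id) R ≤ ∑ (cost g) R)
      × All (λ g → ¬ g ∈supp ω → ∑ (cost id) R < ∑ (cost g) R) gs
    separate-all []       = [] , [] , (λ _ → ℚ.≤-refl) , []
    separate-all {g ∷ gs} (p ∷ ps) with separate-all ps | supp? ω g
    ... | R , R∈ , min , strict | yes g∈ = R , R∈ , min , contradiction g∈ ∷ strict
    ... | R , R∈ , min , strict | no  g∉ =
      let R₀ , R₀∈ , min₀ , strict₀ = separate p g∉ in
      R₀ ++ R , All.++⁺ R₀∈ R∈ ,
      (λ {h} q → subst₂ _≤_ (sym (∑-++ (cost id) R₀ R)) (sym (∑-++ (cost h) R₀ R))
        (ℚ.+-mono-≤ (min₀ q) (min q))) ,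
      (λ _ → subst₂ _<_ (sym (∑-++ (cost id) R₀ R)) (sym (∑-++ (cost g) R₀ R))
        (ℚ.+-mono-<-≤ strict₀ (min p))) ∷
      All.zipWith (λ {h} (q , str) h∉ → subst₂ _<_ (sym (∑-++ (cost id) R₀ R)) (sym (∑-++ (cost h) R₀ R))
        (ℚ.+-mono-≤-< (min₀ q) (str h∉))) (ps , strict)

    separating : ∃ λ R → All (_∈ rows) R
      × (∀ {g} → Good g → ∑ (cost id) R ≤ ∑ (cost g) R)
      × (∀ {g} → Good g → ¬ g ∈supp ω → ∑ (cost id) R < ∑ (cost g) R)
    separating with separate-all (All.tabulate goodMaps-good)
    ... | R , R∈ , min , strict = R , R∈ , min , λ {g} p g∉ →
      let h , h∈ , g≗h = goodMaps-complete p in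
      subst (∑ (cost id) R <_) (∑-cong (cost-cong (sym ∘ g≗h)) R)
        (All.lookup strict h∈ (g∉ ∘ Any.map (λ eq x → trans (g≗h x) (eq x))))

-- The instance

≤-if-finite : ∀ {p} q → (Finite q → p ≤⁺ q) → p ≤⁺ q
≤-if-finite [ q ] le = le [ q ]<⊤⁺
≤-if-finite ⊤⁺    _  = _ ≤⊤⁺

eqFn-refl : ∀ {d} {a b : Fin d} → a ≡ b → eqFn (a ∷ b ∷ []) ≡ [ 0ℚ ]
eqFn-refl {a = a} {b} a≡b with a Fin.≟ b
... | yes _  = refl
... | no a≢b = contradiction a≡b a≢b

eqFn-finite : ∀ {d} {a b : Fin d} → Finite (eqFn (a ∷ b ∷ [])) → a ≡ b
eqFn-finite {a = a} {b} fin with a Fin.≟ b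
eqFn-finite _  | yes a≡b = a≡b
eqFn-finite () | no _

domFn-zero : ∀ {d n} {f : CostFn d n} {x} → x ∈dom f → domFn f x ≡ [ 0ℚ ]
domFn-zero {f = f} {x} p with f x
domFn-zero [ _ ]<⊤⁺ | [ _ ] = refl

domFn-finite : ∀ {d n} (f : CostFn d n) x → Finite (domFn f x) → x ∈dom f
domFn-finite f x p with f x
domFn-finite f x p  | [ q ] = [ q ]<⊤⁺
domFn-finite f x () | ⊤⁺

tabulate-toList : ∀ {A B : Set} {n} (f : A → B) (v : Vec A n) →
  List.tabulate (λ i → f (lookup v i)) ≡ Vec.toList (Vec.map f v)
tabulate-toList f []      = refl
tabulate-toList f (x ∷ v) = cong (f x ∷_) (tabulate-toList f v)

≤⁺-totalOrder : TotalOrder 0ℓ 0ℓ 0ℓ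
≤⁺-totalOrder = record { isTotalOrder = NonStrict.≤⁺-isTotalOrder-≡ ℚ._≤_ ℚ.≤-isTotalOrder }

open Data.List.Extrema ≤⁺-totalOrder using (argmin; f[argmin]≤f[xs])
open TotalOrder ≤⁺-totalOrder using () renaming (trans to ≤⁺-trans; refl to ≤⁺-refl)

module Gadget {d : ℕ} (Γ : Language d) (m : ℕ) .{{_ : NonTrivial m}}
  (has-eq : eqFn ∈ᶜ Γ) (dom-closed : ∀ {n} {f : CostFn d n} → f ∈ᶜ Γ → domFn f ∈ᶜ Γ)
  (x̂ : Vec (Fin d) m) where

  open Tables d m
  open Polymorphisms Γ m

  -- The first `m` variables carry the output `y`; the others carry a table and are minimised out.
  N : ℕ
  N = m ℕ.+ tableSize

  aux : Vec (Fin d) m → Fin m → Fin N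
  aux x i = m ↑ʳ cell x i

  evaluate : Vec (Fin d) N → Term Γ N → ℚ∞
  evaluate v t = Term.cost t (Vec.map (lookup v) (Term.scope t))

  eqTerm : Fin N → Fin N → Term Γ N
  eqTerm a b = record { cost = eqFn ; cost∈Γ = has-eq ; scope = a ∷ b ∷ [] }

  rowTerm : ∀ {n} {f : CostFn d n} → f ∈ᶜ Γ → Matrix d m n → Fin m → Term Γ N
  rowTerm f∈ X i = record { cost∈Γ = f∈ ; scope = Vec.map (λ c → aux c i) (transpose X) }

  outputTerms : List (Term Γ N)
  outputTerms = List.tabulate λ i → eqTerm (i ↑ˡ tableSize) (aux x̂ i)

  -- Coordinate `k` of the symmetry condition for a transposition `τ`: entry `τ k` of the value at
  -- `x` equals entry `k` of the value at the permuted `x`.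
  swapTerms : Vec (Fin d) m × Fin m × Fin m → List (Term Γ N)
  swapTerms (x , i , j) = List.tabulate λ k → eqTerm (aux x (τ ⟨$⟩ʳ k)) (aux (permute τ x) k)
    where τ = Perm.transpose i j

  domTerms costTerms : Row → List (Term Γ N)
  domTerms  r = List.tabulate (rowTerm (dom-closed (fn∈ r)) (proj₂ r))
  costTerms r = List.tabulate (rowTerm (fn∈ r) (proj₂ r))

  -- The hard constraints, which contribute only 0 or ∞; `has-eq` and `dom-closed` supply their cost
  -- functions. Domain constraints are imposed for all of `rows`, not just for those in `R`, since
  -- they must force the table to be good.
  crisp : Instance Γ N
  crisp = outputTerms ++ List.concatMap swapTerms swaps ++ List.concatMap domTerms rows

  gadget : List Row → Instance Γ N
  gadget R = crisp ++ List.concatMap costTerms R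

  module _ (y : Vec (Fin d) m) (z : Vec (Fin d) tableSize) where

    private
      v = y Vec.++ z
      g = toMap z

    lookup-aux : ∀ x i → lookup v (aux x i) ≡ lookup (g x) i
    lookup-aux x i = trans (Vec.lookup-++ʳ y z (cell x i)) (sym (lookup-toMap z x i))

    lookup-output : ∀ i → lookup v (i ↑ˡ tableSize) ≡ lookup y i
    lookup-output i = Vec.lookup-++ˡ y z i

    evaluate-row : ∀ {n} {f : CostFn d n} (f∈ : f ∈ᶜ Γ) X i →
      evaluate v (rowTerm f∈ X i) ≡ f (lookup (act g X) i)
    evaluate-row {f = f} f∈ X i = cong f (trans (sym (Vec.map-∘ (lookup v) (λ c → aux c i) (transpose X)))
      (trans (Vec.map-cong (λ c → lookup-aux c i) (transpose X)) (sym (act-row g X i))))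

    -- A finite sum has only finite terms, so every hard constraint holds. The output constraints
    -- give `y ≡ g x̂` and the others are the clauses of `Checked`.
    gadget-finite : ∀ R → Finite (objective (gadget R) v) → y ≡ g x̂ × Good g
    gadget-finite R fin = Vec-ext output , checked⇒good (All.map swap swapsFinite , All.map dom domsFinite)
      where
      finite : All (Finite ∘ evaluate v) (gadget R)
      finite = All.map⁻ (sum∞-finite⁻ _ fin)
      crispFinite : All (Finite ∘ evaluate v) crisp
      crispFinite = All.++⁻ˡ crisp finite
      output : ∀ i → lookup y i ≡ lookup (g x̂) i
      output i = trans (sym (lookup-output i)) (trans
        (eqFn-finite (All.tabulate⁻ (All.++⁻ˡ outputTerms crispFinite) i)) (lookup-aux x̂ i))
      swapsFinite : All (All (Finite ∘ evaluate v) ∘ swapTerms) swaps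
      swapsFinite = All.map⁻ (All.concat⁻ {xss = List.map swapTerms swaps}
        (All.++⁻ˡ (List.concatMap swapTerms swaps) (All.++⁻ʳ outputTerms crispFinite)))
      domsFinite : All (All (Finite ∘ evaluate v) ∘ domTerms) rows
      domsFinite = All.map⁻ (All.concat⁻ {xss = List.map domTerms rows}
        (All.++⁻ʳ (List.concatMap swapTerms swaps) (All.++⁻ʳ outputTerms crispFinite)))
      swap : ∀ {s} → All (Finite ∘ evaluate v) (swapTerms s) → SwapInvariant g s
      swap {x , i , j} ps = Vec-ext λ k → trans (lookup-permute τ (g x) k) (trans
        (sym (lookup-aux x (τ ⟨$⟩ʳ k))) (trans (eqFn-finite (All.tabulate⁻ ps k)) (lookup-aux (permute τ x) k)))
        where τ = Perm.transpose i j
      dom : ∀ {r} → All (Finite ∘ evaluate v) (domTerms r) → RowDom r g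
      dom {r} ps = VecAll.lookup⁻ λ i → domFn-finite (fn r) _
        (subst Finite (evaluate-row (dom-closed (fn∈ r)) (proj₂ r) i) (All.tabulate⁻ ps i))

    crisp-zero : y ≡ g x̂ → Good g → All ((_≡ [ 0ℚ ]) ∘ evaluate v) crisp
    crisp-zero y≡ p = All.++⁺ (All.tabulate⁺ output)
      (All.++⁺ (All.concat⁺ (All.map⁺ (All.map (All.tabulate⁺ ∘ swap) (proj₁ (good⇒checked p)))))
        (All.concat⁺ (All.map⁺ (All.map (λ {r} ps → All.tabulate⁺ (dom {r} ps)) (proj₂ (good⇒checked p))))))
      where
      output : ∀ i → evaluate v (eqTerm (i ↑ˡ tableSize) (aux x̂ i)) ≡ [ 0ℚ ]
      output i = eqFn-refl (trans (lookup-output i) (trans (cong (λ y → lookup y i) y≡) (sym (lookup-aux x̂ i))))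
      swap : ∀ {s} → SwapInvariant g s → let x , i , j = s; τ = Perm.transpose i j in
        ∀ k → evaluate v (eqTerm (aux x (τ ⟨$⟩ʳ k)) (aux (permute τ x) k)) ≡ [ 0ℚ ]
      swap {x , i , j} eq k = eqFn-refl (trans (lookup-aux x (τ ⟨$⟩ʳ k)) (trans
        (sym (lookup-permute τ (g x) k)) (trans (cong (λ u → lookup u k) eq) (sym (lookup-aux (permute τ x) k)))))
        where τ = Perm.transpose i j
      dom : ∀ {r} → RowDom r g → ∀ i → evaluate v (rowTerm (dom-closed (fn∈ r)) (proj₂ r) i) ≡ [ 0ℚ ]
      dom {r} ps i = trans (evaluate-row (dom-closed (fn∈ r)) (proj₂ r) i)
        (domFn-zero {f = fn r} (VecAll.lookup⁺ ps i))

    costTerms-value : ∀ {r} → RowDom r g → sum∞ (List.map (evaluate v) (costTerms r)) ≡ [ cost g r ]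
    costTerms-value {r} ps = trans (cong sum∞ (trans
      (List.map-tabulate (rowTerm (fn∈ r) (proj₂ r)) (evaluate v))
      (trans (List.tabulate-cong (evaluate-row (fn∈ r) (proj₂ r)))
        (tabulate-toList (fn r) (act g (proj₂ r)))))) (sum∞-total ps)

    allCostTerms-value : ∀ {R} → All (λ r → RowDom r g) R →
      sum∞ (List.map (evaluate v) (List.concatMap costTerms R)) ≡ [ ∑ (cost g) R ]
    allCostTerms-value []                   = refl
    allCostTerms-value {r ∷ R} (p ∷ ps) = trans
      (cong sum∞ (List.map-++ (evaluate v) (costTerms r) (List.concatMap costTerms R)))
      (trans (sum∞-++ (List.map (evaluate v) (costTerms r)) _)
        (cong₂ _+∞_ (costTerms-value p) (allCostTerms-value ps)))

    -- The hard constraints add 0, and goodness of `g` makes the cost terms finite, as `R` consists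
    -- of members of `rows`.
    gadget-value : ∀ {R} → All (_∈ rows) R → y ≡ g x̂ → Good g →
      objective (gadget R) v ≡ [ ∑ (cost g) R ]
    gadget-value {R} R∈ y≡ p = trans
      (cong sum∞ (List.map-++ (evaluate v) crisp (List.concatMap costTerms R)))
      (trans (sum∞-++ (List.map (evaluate v) crisp) _)
      (trans (cong₂ _+∞_ (sum∞-zero (All.map⁺ (crisp-zero y≡ p)))
               (allCostTerms-value (All.map (All.lookup (proj₂ (good⇒checked p))) R∈)))
        (cong [_] (ℚ.+-identityˡ (∑ (cost g) R)))))

  module Projection (R : List Row) where

    projection : CostFn d m
    projection y = objective (gadget R)
      -- `fromMap id` is only the initial candidate of the search; `tables` contains every table, so
      -- the minimum is over all of them.
      (y Vec.++ argmin (λ z → objective (gadget R) (y Vec.++ z)) (fromMap id) tables)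

    projection-≤ : ∀ y z → projection y ≤⁺ objective (gadget R) (y Vec.++ z)
    projection-≤ y z = All.lookup
      (f[argmin]≤f[xs] {f = λ z → objective (gadget R) (y Vec.++ z)} (fromMap id) tables)
      (∈-vectors ∈-allFin z)

    projection∈ : projection ∈⟨ Γ ⟩
    projection∈ = tableSize , gadget R , λ y → projection-≤ y , _ , refl

-- Minimizers of the projected cost function

theorem6p3 : ∀ {d : ℕ} (Γ : Language d) → BlockFinite Γ →
    ∀ (m : ℕ) .{{_ : NonTrivial m}} (ω : Distribution d m) → IsMaximalSym Γ m ω →
    ∀ (x̂ : Vec (Fin d) m) →
    ∃ λ (f : CostFn d m) → f ∈⟨ Γ ⟩ × (∀ y → y ∈argmin f ⇔ y ∈𝔾[ ω ] x̂)
theorem6p3 {d} Γ blockFinite m ω isMaximal x̂ with Polymorphisms.separating Γ m isMaximal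
... | R , R∈ , id-minimal , strict = projection , projection∈ , λ y → mk⇔ (⇒ y) (⇐ y)
  where
  open Tables d m
  open Polymorphisms Γ m
  open BlockFinite blockFinite
  open Gadget Γ m has-eq dom-closed x̂
  open Projection R

  M : ℚ
  M = ∑ (cost id) R

  -- The table of `g` satisfies all hard constraints when the output is `g x̂`, so it is a candidate
  -- in the minimum.
  table-bound : ∀ {g} → Good g → projection (g x̂) ≤⁺ [ ∑ (cost g) R ]
  table-bound {g} p = subst (projection (g x̂) ≤⁺_)
    (trans (gadget-value (g x̂) z R∈ (sym (toMap-fromMap g x̂)) (good-cong (sym ∘ toMap-fromMap g) p))
      (cong [_] (∑-cong (cost-cong (toMap-fromMap g)) R)))
    (projection-≤ (g x̂) z)
    where z = fromMap g

  -- An assignment has infinite objective or encodes a good map, whose cost is at least that of the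
  -- identity.
  M≤ : ∀ y z → [ M ] ≤⁺ objective (gadget R) (y Vec.++ z)
  M≤ y z = ≤-if-finite (objective (gadget R) (y Vec.++ z)) λ fin → let y≡ , p = gadget-finite y z R fin in
    subst ([ M ] ≤⁺_) (sym (gadget-value y z R∈ y≡ p)) [ id-minimal p ]

  ⇒ : ∀ y → y ∈argmin projection → y ∈𝔾[ ω ] x̂
  -- The optimal table of a minimizer encodes a map in the support itself, so a single factor
  -- suffices.
  ⇒ y minimal = g , (g ∷ [] , g∈ ∷ [] , λ _ → refl) , y≡
    where
    z = proj₁ (proj₂ (proj₂ (proj₂ projection∈) y))
    le : objective (gadget R) (y Vec.++ z) ≤⁺ [ M ]
    -- The minimizer is compared with `x̂`, the output of the identity, where the projection is at
    -- most `M`.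
    le = ≤⁺-trans (minimal x̂) (table-bound good-id)
    g = toMap z
    feasible = gadget-finite y z R (≤-finite le)
    y≡ = proj₁ feasible
    g∈ : g ∈supp ω
    -- Outside the support the cost of `g` would exceed `M`; membership in the support is decidable,
    -- so refuting this is enough.
    g∈ = decidable-stable (supp? ω g) λ g∉ → ≤⇒≯
      (NonStrict.[≤]-injective ℚ._≤_ (subst (_≤⁺ [ M ]) (gadget-value y z R∈ y≡ (proj₂ feasible)) le))
      (strict (proj₂ feasible) g∉)

  ⇐ : ∀ y → y ∈𝔾[ ω ] x̂ → y ∈argmin projection
  -- The composite has cost `M`, so the projection at `y` is at most `M`, a lower bound for the
  -- objective everywhere.
  ⇐ y (g , (gs , gs∈ , g≗) , y≡gx̂) y′ = ≤⁺-trans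
    (subst₂ (λ a b → projection a ≤⁺ [ b ]) (sym (trans y≡gx̂ (g≗ x̂))) (proj₂ optimal) (table-bound (proj₁ optimal)))
    (M≤ y′ _)
    where optimal = generated-optimal isMaximal R R∈ id-minimal gs∈
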